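{- Let $n\ge 3$. Then for $0\le k<n-1$, $$f(n,k)=\sum_{j=k-1}^{n-2} f(n-1,j),$$ and $$f(n,n-1)=\sum_{j=0}^{n-4}(n-3-j)\,f(n-1,j),$$ with the convention $f(m,-1)=0$.
   Context: A complete non-ambiguous matrix (CNM) of size $n$ is an $n\times n$ matrix $M=(m_{i,j})$ with entries in $\{0,1\}$ whose support $T=\{(i,j): m_{i,j}=1\}$ (whose elements are called vertices) satisfies: (1) $(1,1)\in T$; (2) for every $p=(i,j)\in T$ with $p\neq(1,1)$, exactly one of the following holds: there is $(i',j)\in T$ with $i'<i$, or there is $(i,j')\in T$ with $j'<j$; (3) every row and every column of $M$ contains at least one vertex; (4) define the parent of $p=(i,j)\neq(1,1)$ to be $(i',j)$ with $i'<i$ maximal if such a vertex exists, and otherwise $(i,j')$ with $j'<j$ maximal; then every vertex is the parent of either zero or exactly two vertices. A vertex with no children is a leaf. A CNM of size $n$ is upper-diagonal if its leaves are exactly the positions $(i,n+1-i)$, $1\le i\le n$. For $n\ge 2$ and $0\le k\le n-2$, $f(n,k)$ is the number of upper-diagonal CNMs $M$ of size $n$ with $m_{i,n-i}=0$ for $1\le i\le k$ and $m_{k+1,n-k-1}=1$; $f(n,n-1)$ is the number of upper-diagonal CNMs of size $n$ with $m_{i,n-i}=0$ for all $1\le i\le n-1$; by convention $f(n,-1)=0$. -}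

module Defs where

open import Data.Bool using (Bool; true; false)
import Data.Bool.Properties as Bool
open import Data.Fin using (Fin; toℕ)
import Data.Fin.Properties as Fin
open import Data.Integer as ℤ using (ℤ; +_; -[1+_])
open import Data.List as List using (List; []; _∷_; length; filter; cartesianProductWith; upTo)
open import Data.Nat using (ℕ; zero; suc; _+_; _≤_; _<_; _≟_; _≤?_; _<?_)
open import Data.Product using (∃; _×_; _,_; proj₁; proj₂; curry; uncurry)
open import Data.Product.Properties using (≡-dec)
open import Data.Sum using (_⊎_)
open import Data.Vec as Vec using (Vec; lookup)
open import Function using (_∘_; _⇔_; mk⇔; Equivalence)
open import Level using (0ℓ)
open import Relation.Binary.Definitions using (DecidableEquality)
open import Relation.Binary.PropositionalEquality using (_≡_; _≢_)
open import Relation.Nullary using (¬_; Dec)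
open import Relation.Nullary.Decidable using (map′; _×-dec_; _⊎-dec_; _→-dec_; ¬?)
open import Relation.Unary using (Pred; Decidable)

private
  variable
    n : ℕ

-- `true` is the entry 1, `false` the entry 0.
Matrix : ℕ → Set
Matrix n = Vec (Vec Bool n) n

Position : ℕ → Set
Position n = Fin n × Fin n

-- 1-based coordinates.
row col : Position n → ℕ
row = suc ∘ toℕ ∘ proj₁
col = suc ∘ toℕ ∘ proj₂

Vertex : Matrix n → Pred (Position n) 0ℓ
Vertex M (i , j) = lookup (lookup M i) j ≡ true

IsRoot : Pred (Position n) 0ℓ
IsRoot p = row p ≡ 1 × col p ≡ 1

-- `Above M p q` and `LeftOf M p q`: q is a vertex above, resp. left of, p.
Above LeftOf : Matrix n → Position n → Pred (Position n) 0ℓ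
Above  M p q = Vertex M q × col q ≡ col p × row q < row p
LeftOf M p q = Vertex M q × row q ≡ row p × col q < col p

NearestAbove NearestLeft : Matrix n → Position n → Pred (Position n) 0ℓ
NearestAbove M p q = Above  M p q × (∀ r → Above  M p r → row r ≤ row q)
NearestLeft  M p q = LeftOf M p q × (∀ r → LeftOf M p r → col r ≤ col q)

-- q is the parent of p.
Parent : Matrix n → Position n → Pred (Position n) 0ℓ
Parent M p q =
  Vertex M p × ¬ IsRoot p ×
  (NearestAbove M p q ⊎ (¬ ∃ (Above M p)) × NearestLeft M p q)

Childless : Matrix n → Pred (Position n) 0ℓ
Childless M q = ¬ ∃ λ p → Parent M p q

TwoChildren : Matrix n → Pred (Position n) 0ℓ
TwoChildren M q =
  ∃ λ p₁ → ∃ λ p₂ → p₁ ≢ p₂ × (∀ p → Parent M p q ⇔ (p ≡ p₁ ⊎ p ≡ p₂))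

Leaf : Matrix n → Pred (Position n) 0ℓ
Leaf M p = Vertex M p × Childless M p

ExactlyOne : Set → Set → Set
ExactlyOne A B = (A × ¬ B) ⊎ (¬ A × B)

record IsCNM (M : Matrix n) : Set where
  field
    root      : ∃ λ p → IsRoot p × Vertex M p
    connected : ∀ p → Vertex M p → ¬ IsRoot p →
                ExactlyOne (∃ (Above M p)) (∃ (LeftOf M p))
    rows      : ∀ i → ∃ λ j → Vertex M (i , j)
    columns   : ∀ j → ∃ λ i → Vertex M (i , j)
    complete  : ∀ p → Vertex M p → Childless M p ⊎ TwoChildren M p

IsUpperDiagonalCNM : Pred (Matrix n) 0ℓ
IsUpperDiagonalCNM {n} M = IsCNM M × (∀ p → Leaf M p ⇔ row p + col p ≡ suc n)

-- m_{i,n-i} = 0 for 1 ≤ i ≤ k, and either m_{k+1,n-k-1} = 1 or k = n - 1.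
-- The first alternative can only hold when k ≤ n - 2.
StartsAt : ℕ → Pred (Matrix n) 0ℓ
StartsAt {n} k M =
  (∀ p → row p + col p ≡ n → row p ≤ k → ¬ Vertex M p) ×
  ((∃ λ p → row p ≡ suc k × row p + col p ≡ n × Vertex M p) ⊎ suc k ≡ n)

allVecs : {A : Set} → List A → ∀ n → List (Vec A n)
allVecs xs zero    = Vec.[] ∷ []
allVecs xs (suc n) = cartesianProductWith Vec._∷_ xs (allVecs xs n)

allMatrices : ∀ n → List (Matrix n)
allMatrices n = allVecs (allVecs (false ∷ true ∷ []) n) n

any? : {P : Pred (Position n) 0ℓ} → Decidable P → Dec (∃ P)
any? P? = map′ (λ (i , j , p) → (i , j) , p) (λ ((i , j) , p) → i , j , p)
  (Fin.any? λ i → Fin.any? λ j → P? (i , j))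

all? : {P : Pred (Position n) 0ℓ} → Decidable P → Dec (∀ p → P p)
all? P? = map′ uncurry curry (Fin.all? λ i → Fin.all? λ j → P? (i , j))

_≟ₚ_ : DecidableEquality (Position n)
_≟ₚ_ = ≡-dec Fin._≟_ Fin._≟_

_⇔-dec_ : {A B : Set} → Dec A → Dec B → Dec (A ⇔ B)
a? ⇔-dec b? = map′ (λ (f , g) → mk⇔ f g) (λ e → Equivalence.to e , Equivalence.from e)
  ((a? →-dec b?) ×-dec (b? →-dec a?))

exactlyOne? : {A B : Set} → Dec A → Dec B → Dec (ExactlyOne A B)
exactlyOne? a? b? = (a? ×-dec ¬? b?) ⊎-dec (¬? a? ×-dec b?)

module _ (M : Matrix n) where

  vertex? : Decidable (Vertex M)
  vertex? (i , j) = lookup (lookup M i) j Bool.≟ true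

  isRoot? : Decidable (IsRoot {n})
  isRoot? p = (row p ≟ 1) ×-dec (col p ≟ 1)

  above? : ∀ p → Decidable (Above M p)
  above? p q = vertex? q ×-dec (col q ≟ col p) ×-dec (row q <? row p)

  leftOf? : ∀ p → Decidable (LeftOf M p)
  leftOf? p q = vertex? q ×-dec (row q ≟ row p) ×-dec (col q <? col p)

  parent? : ∀ p → Decidable (Parent M p)
  parent? p q =
    vertex? p ×-dec ¬? (isRoot? p) ×-dec
    ((above? p q ×-dec all? (λ r → above? p r →-dec (row r ≤? row q)))
     ⊎-dec
     (¬? (any? (above? p)) ×-dec
      (leftOf? p q ×-dec all? (λ r → leftOf? p r →-dec (col r ≤? col q)))))

  childless? : Decidable (Childless M)
  childless? q = ¬? (any? λ p → parent? p q)

  twoChildren? : Decidable (TwoChildren M)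
  twoChildren? q = any? λ p₁ → any? λ p₂ →
    ¬? (p₁ ≟ₚ p₂) ×-dec
    all? (λ p → parent? p q ⇔-dec ((p ≟ₚ p₁) ⊎-dec (p ≟ₚ p₂)))

  leaf? : Decidable (Leaf M)
  leaf? p = vertex? p ×-dec childless? p

  isCNM? : Dec (IsCNM M)
  isCNM? = map′
    (λ (a , b , c , d , e) → record
      { root = a ; connected = b ; rows = c ; columns = d ; complete = e })
    (λ h → let open IsCNM h in root , connected , rows , columns , complete)
    (any? (λ p → isRoot? p ×-dec vertex? p) ×-dec
     all? (λ p → vertex? p →-dec (¬? (isRoot? p) →-dec
       exactlyOne? (any? (above? p)) (any? (leftOf? p)))) ×-dec
     Fin.all? (λ i → Fin.any? λ j → vertex? (i , j)) ×-dec
     Fin.all? (λ j → Fin.any? λ i → vertex? (i , j)) ×-dec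
     all? (λ p → vertex? p →-dec (childless? p ⊎-dec twoChildren? p)))

  isUpperDiagonalCNM? : Dec (IsUpperDiagonalCNM M)
  isUpperDiagonalCNM? =
    isCNM? ×-dec all? (λ p → leaf? p ⇔-dec (row p + col p ≟ suc n))

  startsAt? : ∀ k → Dec (StartsAt k M)
  startsAt? k =
    all? (λ p → (row p + col p ≟ n) →-dec ((row p ≤? k) →-dec ¬? (vertex? p)))
    ×-dec
    (any? (λ p → (row p ≟ suc k) ×-dec (row p + col p ≟ n) ×-dec vertex? p)
     ⊎-dec (suc k ≟ n))

-- The first argument is the size of the matrices.  The value is 0 at negative
-- arguments by convention, and at k ≥ n because `StartsAt k` is then empty.
f : ℕ → ℤ → ℕ
f n (+ k)    = length (filter (λ M → isUpperDiagonalCNM? M ×-dec startsAt? M k) (allMatrices n))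
f n -[1+ _ ] = 0

clip : ℤ → ℕ
clip (+ m)    = m
clip -[1+ _ ] = 0

-- Both bounds are included; the sum is empty when b < a.
sumFromTo : ℤ → ℤ → (ℤ → ℤ) → ℤ
sumFromTo a b g =
  List.foldr ℤ._+_ (+ 0)
    (List.map (λ i → g (a ℤ.+ + i)) (upTo (clip (b ℤ.- a ℤ.+ + 1))))

infix 0 sumFromTo
syntax sumFromTo a b (λ j → e) = Σ[ j from a to b ] e

{-
The leaves of an upper-diagonal CNM fill the antidiagonal, and no vertex lies beyond it; conversely a
staircase-shaped matrix containing the antidiagonal and the root, in which every other vertex has
exactly one of a vertex above and a vertex to the left, is an upper-diagonal CNM.  Such matrices are
counted row by row from the top, remembering only the vector a of columns occupied so far.

The first recurrence is the contraction of the dot (k+1, n-k-1) and its two leaves to a single leaf.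
For the second, the number of fillings below a is the product of c - 1 over the columns c not
marked in a, so there are (n-1)! upper-diagonal CNMs of size n; f(n, n-1) is what remains of this
total after subtracting the other f(n, k), which are known from the first recurrence.
-}

module Submission where

open import Defs
open import Data.Integer using (ℤ; +_; _-_; _*_)
open import Data.Nat using (ℕ; _≤_; _<_; _∸_)
open import Data.Product using (_×_)
open import Relation.Binary.PropositionalEquality using (_≡_)

open import Algebra.Properties.CommutativeSemigroup using (interchange)
open import Data.Bool using (Bool; true; false; if_then_else_; _∧_; _∨_; _xor_; not; T)
open import Data.Bool.Properties using (T?; T-∧; ⇔→≡; ∧-identityʳ; ∨-identityʳ)
open import Data.Empty using (⊥; ⊥-elim)
open import Data.Fin as Fin using (Fin; zero; suc; toℕ; fromℕ<; inject₁)
import Data.Fin.Properties as Fin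
import Data.Integer as ℤ
import Data.Integer.Properties as ℤ
open import Data.List as List using
  (List; []; _∷_; _++_; applyUpTo; cartesianProductWith; filter; foldr; length; map)
import Data.List.Properties as List
open import Data.List.Membership.Propositional using (_∈_)
import Data.List.Membership.Propositional.Properties as ∈
open import Data.List.Membership.Propositional.Properties.WithK using (unique∧set⇒bag)
open import Data.List.Relation.Binary.BagAndSetEquality using (∼bag⇒↭)
open import Data.List.Relation.Binary.Permutation.Propositional.Properties using (↭-length)
open import Data.List.Relation.Unary.All using ([]; _∷_)
open import Data.List.Relation.Unary.AllPairs using ([]; _∷_)
open import Data.List.Relation.Unary.Any using (here; there)
open import Data.List.Relation.Unary.Unique.Propositional using (Unique)
import Data.List.Relation.Unary.Unique.Propositional.Properties as Unique
open import Data.Nat as ℕ using (zero; suc; pred; _+_; _≟_; z≤n; s≤s; s≤s⁻¹; z<s; s<s; s<s⁻¹)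
open import Data.Nat.Induction using (<-rec)
open import Data.Nat.ListAction using (sum)
open import Data.Nat.ListAction.Properties using (sum-++)
open import Data.Nat.Properties
open import Data.Nat.Solver using (module +-*-Solver)
open import Data.Product using (∃; _,_; proj₁; proj₂; map₂)
open import Data.Sum as Sum using (_⊎_; inj₁; inj₂; [_,_]′)
open import Data.Unit using (tt)
open import Data.Vec using (Vec; []; _∷_; insertAt; lookup; tabulate; tail; zipWith)
import Data.Vec.Properties as Vec
open import Function using (_∘_; id; _⇔_; mk⇔; Equivalence)
open import Function.Construct.Identity using (⇔-id)
open import Function.Construct.Symmetry using (⇔-sym)
open import Level using (0ℓ)
open import Relation.Binary using (tri<; tri≈; tri>)
open import Relation.Binary.PropositionalEquality using
  (_≢_; refl; sym; trans; cong; cong₂; subst; subst₂; module ≡-Reasoning)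
open import Relation.Nullary using (¬_; Dec; yes; no; does; contradiction)
open import Relation.Nullary.Decidable using (_×-dec_; dec-true)
open import Relation.Unary using (Pred; Decidable)
open Equivalence using (to; from)

private variable
  n : ℕ
  A B A′ B′ C : Set

-- The row-by-row recursion

-- `rowSum a g` is the sum of g (a ∨ r) over the nonempty rows r in which every vertex has
-- exactly one of a vertex to its left and a vertex above, if the columns marked in a are those
-- occupied above.  Rows are stored from right to left.
rowSum : Vec Bool n → (Vec Bool n → ℕ) → ℕ
rowSum []          g = 0
rowSum (true  ∷ a) g = rowSum a (g ∘ (true ∷_)) + g (true ∷ a)
rowSum (false ∷ a) g = rowSum a (g ∘ (false ∷_)) + rowSum a (g ∘ (true ∷_))

rowSum-cong : ∀ (a : Vec Bool n) {g h} → (∀ b → g b ≡ h b) → rowSum a g ≡ rowSum a h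
rowSum-cong []          e = refl
rowSum-cong (true  ∷ a) e = cong₂ _+_ (rowSum-cong a (e ∘ (true ∷_))) (e (true ∷ a))
rowSum-cong (false ∷ a) e =
  cong₂ _+_ (rowSum-cong a (e ∘ (false ∷_))) (rowSum-cong a (e ∘ (true ∷_)))

rowSum-+ : ∀ (a : Vec Bool n) g h → rowSum a (λ b → g b + h b) ≡ rowSum a g + rowSum a h
rowSum-+ []          g h = refl
rowSum-+ (true  ∷ a) g h = trans (cong₂ _+_ (rowSum-+ a _ _) refl)
  (interchange +-commutativeSemigroup (rowSum a (g ∘ (true ∷_))) _ (g (true ∷ a)) _)
rowSum-+ (false ∷ a) g h = trans (cong₂ _+_ (rowSum-+ a _ _) (rowSum-+ a _ _))
  (interchange +-commutativeSemigroup (rowSum a (g ∘ (false ∷_))) _ (rowSum a (g ∘ (true ∷_))) _)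

rowSum-0 : ∀ (a : Vec Bool n) → rowSum a (λ _ → 0) ≡ 0
rowSum-0 []          = refl
rowSum-0 (true  ∷ a) rewrite rowSum-0 a = refl
rowSum-0 (false ∷ a) rewrite rowSum-0 a = refl

rowSum-* : ∀ (a : Vec Bool n) c g → rowSum a (λ b → c ℕ.* g b) ≡ c ℕ.* rowSum a g
rowSum-* []          c g = sym (*-zeroʳ c)
rowSum-* (true  ∷ a) c g = trans (cong₂ _+_ (rowSum-* a c _) refl) (sym (*-distribˡ-+ c _ _))
rowSum-* (false ∷ a) c g =
  trans (cong₂ _+_ (rowSum-* a c _) (rowSum-* a c _)) (sym (*-distribˡ-+ c _ _))

-- If the column of the leaf of the current row (the head) is occupied above, then the row
-- contains no other vertex.
fillings : Vec Bool n → ℕ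
fillings []          = 1
fillings (true  ∷ a) = fillings a
fillings (false ∷ a) = rowSum a fillings

columnProduct : Vec Bool n → ℕ
columnProduct []                  = 1
columnProduct (true ∷ a)          = columnProduct a
columnProduct {suc n} (false ∷ a) = n ℕ.* columnProduct a

-- `columnProduct` is an eigenvector of `rowSum`, with the number of columns as eigenvalue. If the
-- rightmost column is unmarked, it contributes a factor `n` when it stays so and 1 when it gets
-- marked, which turns the sum over the other `n` columns into `suc n` times itself. If it is
-- marked, the extra summand is the row whose only vertex lies in it. Thus `columnProduct` satisfies
-- the recursion of `fillings`.
rowSum-columnProduct : ∀ (a : Vec Bool n) → rowSum a columnProduct ≡ n ℕ.* columnProduct a
rowSum-columnProduct []          = refl
rowSum-columnProduct {suc n} (true  ∷ a) =
  trans (cong₂ _+_ (rowSum-columnProduct a) refl) (+-comm _ (columnProduct a))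
rowSum-columnProduct {suc n} (false ∷ a) = begin
  rowSum a (λ b → n ℕ.* columnProduct b) + rowSum a columnProduct
    ≡⟨ cong₂ _+_ (rowSum-* a n columnProduct) refl ⟩
  n ℕ.* rowSum a columnProduct + rowSum a columnProduct
    ≡⟨ +-comm _ (rowSum a columnProduct) ⟩
  suc n ℕ.* rowSum a columnProduct
    ≡⟨ cong (suc n ℕ.*_) (rowSum-columnProduct a) ⟩
  suc n ℕ.* (n ℕ.* columnProduct a) ∎
  where open ≡-Reasoning

fillings≡columnProduct : ∀ (a : Vec Bool n) → fillings a ≡ columnProduct a
fillings≡columnProduct []          = refl
fillings≡columnProduct (true  ∷ a) = fillings≡columnProduct a
fillings≡columnProduct (false ∷ a) =
  trans (rowSum-cong a fillings≡columnProduct) (rowSum-columnProduct a)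

-- A row is dotted if the entry to the left of its leaf, m_{i,n-i}, is 1.  The last row, which has
-- no such entry, counts as dotted: then f(n, n-1) needs no special treatment.
undottedRowSum dottedRowSum : Vec Bool n → (∀ {m} → Vec Bool m → ℕ) → ℕ
undottedRowSum []              g = 0
undottedRowSum (x ∷ [])        g = 0
undottedRowSum (true  ∷ y ∷ a) g = g (y ∷ a)
undottedRowSum (false ∷ y ∷ a) g = rowSum a (λ b → g (y ∷ b))
dottedRowSum []                  g = 0
dottedRowSum (true  ∷ [])        g = g []
dottedRowSum (false ∷ [])        g = 0
dottedRowSum (true  ∷ y ∷ a)     g = 0
dottedRowSum (false ∷ true  ∷ a) g = g (true ∷ a)
dottedRowSum (false ∷ false ∷ a) g = rowSum a (λ b → g (true ∷ b))

startingAt : ℕ → Vec Bool n → ℕ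
startingAt zero    a = dottedRowSum a fillings
startingAt (suc k) a = undottedRowSum a (startingAt k)

startingFrom : ℕ → Vec Bool n → ℕ
startingFrom zero    a = fillings a
startingFrom (suc k) a = undottedRowSum a (startingFrom k)

undottedRowSum-cong : ∀ (a : Vec Bool n) {g h : ∀ {m} → Vec Bool m → ℕ} →
  (∀ {m} (b : Vec Bool (suc m)) → g b ≡ h b) →
  undottedRowSum a g ≡ undottedRowSum a h
undottedRowSum-cong []              e = refl
undottedRowSum-cong (x ∷ [])        e = refl
undottedRowSum-cong (true  ∷ y ∷ a) e = e (y ∷ a)
undottedRowSum-cong (false ∷ y ∷ a) e = rowSum-cong a (λ b → e (y ∷ b))

undottedRowSum-+ : ∀ (a : Vec Bool n) (g h : ∀ {m} → Vec Bool m → ℕ) →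
  undottedRowSum a (λ b → g b + h b) ≡ undottedRowSum a g + undottedRowSum a h
undottedRowSum-+ []              g h = refl
undottedRowSum-+ (x ∷ [])        g h = refl
undottedRowSum-+ (true  ∷ y ∷ a) g h = refl
undottedRowSum-+ (false ∷ y ∷ a) g h = rowSum-+ a _ _

-- After `k` undotted rows the next one is dotted or not. For `k = 0` this splits the recursion of
-- `fillings` according to the entry left of the leaf.
startingFrom-suc : ∀ k (a : Vec Bool (suc n)) →
  startingFrom k a ≡ startingAt k a + startingFrom (suc k) a
startingFrom-suc zero    (true  ∷ [])        = refl
startingFrom-suc zero    (true  ∷ y ∷ a)     = refl
startingFrom-suc zero    (false ∷ [])        = refl
startingFrom-suc zero    (false ∷ true  ∷ a) = +-comm _ (fillings (true ∷ a))
startingFrom-suc zero    (false ∷ false ∷ a) = +-comm (rowSum a (fillings ∘ (false ∷_))) _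
startingFrom-suc (suc k) a = trans
  (undottedRowSum-cong a (startingFrom-suc k))
  (undottedRowSum-+ a (startingAt k) (startingFrom (suc k)))

-- The last row counts as dotted, so the rows cannot all be undotted. This closes the telescoping
-- sums of `startingAt`.
startingFrom-length : (a : Vec Bool (suc n)) → startingFrom (suc n) a ≡ 0
startingFrom-length (x ∷ [])        = refl
startingFrom-length (true  ∷ y ∷ a) = startingFrom-length (y ∷ a)
startingFrom-length (false ∷ y ∷ a) =
  trans (rowSum-cong a (λ b → startingFrom-length (y ∷ b))) (rowSum-0 a)

-- Contracting the first dot

rowSum-insertAt-true : ∀ (a : Vec Bool n) i {g} → (∀ b → g (insertAt b i true) ≡ 0) →
  rowSum (insertAt a i true) g ≡ 0
rowSum-insertAt-true a           zero    z = cong₂ _+_ (trans (rowSum-cong a z) (rowSum-0 a)) (z a)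
rowSum-insertAt-true (true  ∷ a) (suc i) z =
  cong₂ _+_ (rowSum-insertAt-true a i (z ∘ (true ∷_))) (z (true ∷ a))
rowSum-insertAt-true (false ∷ a) (suc i) z =
  cong₂ _+_ (rowSum-insertAt-true a i (z ∘ (false ∷_))) (rowSum-insertAt-true a i (z ∘ (true ∷_)))

-- Only rows without a vertex in the inserted column contribute, and such a column affects neither
-- the nonemptiness of the row nor the condition on its vertices.
rowSum-insertAt-false : ∀ (a : Vec Bool n) i {g} → (∀ b → g (insertAt b i true) ≡ 0) →
  rowSum (insertAt a i false) g ≡ rowSum a (λ b → g (insertAt b i false))
rowSum-insertAt-false a           zero    z =
  trans (cong₂ _+_ refl (trans (rowSum-cong a z) (rowSum-0 a))) (+-identityʳ _)
rowSum-insertAt-false (true  ∷ a) (suc i) z =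
  cong₂ _+_ (rowSum-insertAt-false a i (z ∘ (true ∷_))) refl
rowSum-insertAt-false (false ∷ a) (suc i) z =
  cong₂ _+_ (rowSum-insertAt-false a i (z ∘ (false ∷_))) (rowSum-insertAt-false a i (z ∘ (true ∷_)))

-- The inserted column is that of the leaf of the row to be dotted. A marked column stays marked, so
-- this leaf has a vertex above it and cannot have the dot to its left as well. `inject₁` excludes
-- the leftmost column, whose leaf is in the last row.
startingAt-occupied : ∀ (a : Vec Bool (suc n)) i →
  startingAt (toℕ i) (insertAt a (inject₁ i) true) ≡ 0
startingAt-occupied (x ∷ a)         zero          = refl
startingAt-occupied (true  ∷ a)     (suc zero)    = startingAt-occupied a zero
startingAt-occupied (false ∷ a)     (suc zero)    =
  trans (rowSum-cong a (λ b → startingAt-occupied b zero)) (rowSum-0 a)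
startingAt-occupied (true  ∷ y ∷ a) (suc (suc i)) = startingAt-occupied (y ∷ a) (suc i)
startingAt-occupied (false ∷ y ∷ a) (suc (suc i)) =
  rowSum-insertAt-true a (inject₁ i) (λ b → startingAt-occupied (y ∷ b) (suc i))

-- Contracting the dot (k+1, n-k-1) of a matrix starting at k to a leaf deletes row k+2 and
-- column n-k; the latter contains no other vertex than the leaf of row k+1.
startingAt-insertAt : ∀ (a : Vec Bool (suc n)) i →
  startingAt (toℕ i) (insertAt a (inject₁ i) false) ≡ startingFrom (pred (toℕ i)) a
startingAt-insertAt (true  ∷ a)     zero          = refl
startingAt-insertAt (false ∷ a)     zero          = refl
-- For the row just above the dotted one, being undotted concerns exactly the inserted column. This
-- condition vanishes with the column, whence `pred`.
startingAt-insertAt (true  ∷ a)     (suc zero)    = startingAt-insertAt a zero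
startingAt-insertAt (false ∷ a)     (suc zero)    =
  rowSum-cong a (λ b → startingAt-insertAt b zero)
startingAt-insertAt (true  ∷ y ∷ a) (suc (suc i)) = startingAt-insertAt (y ∷ a) (suc i)
startingAt-insertAt (false ∷ y ∷ a) (suc (suc i)) =
  trans (rowSum-insertAt-false a (inject₁ i) (λ b → startingAt-occupied (y ∷ b) (suc i)))
        (rowSum-cong a (λ b → startingAt-insertAt (y ∷ b) (suc i)))

-- Counting staircases

-- The entries strictly above the antidiagonal; the ones on it are 1, those below it 0.
data Staircase : ℕ → Set where
  []  : Staircase 0
  _∷_ : Vec Bool n → Staircase n → Staircase (suc n)

∷-injective : ∀ {r r′ : Vec Bool n} {s s′} → _≡_ {A = Staircase _} (r ∷ s) (r′ ∷ s′) → r ≡ r′ × s ≡ s′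
∷-injective refl = refl , refl

nonempty : Vec Bool n → Bool
nonempty []      = false
nonempty (x ∷ r) = x ∨ nonempty r

connectedRow : Vec Bool n → Vec Bool n → Bool
connectedRow []      []          = true
connectedRow (x ∷ a) (false ∷ r) = connectedRow a r
connectedRow (x ∷ a) (true  ∷ r) = (x xor nonempty r) ∧ connectedRow a r

-- `true ∷ r` restores the leaf to the row. `tail` forgets the column of that leaf, in which a
-- staircase has nothing further down.
connectedBelow : Vec Bool n → Staircase n → Bool
connectedBelow a []      = true
connectedBelow a (r ∷ s) =
  connectedRow a (true ∷ r) ∧ connectedBelow (zipWith _∨_ (tail a) r) s

dotted : Vec Bool n → Bool
dotted []      = true
dotted (x ∷ r) = x

startsAtᵇ : ℕ → Staircase n → Bool
startsAtᵇ k       []      = false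
startsAtᵇ zero    (r ∷ s) = dotted r
startsAtᵇ (suc k) (r ∷ s) = not (dotted r) ∧ startsAtᵇ k s

allRows : ∀ n → List (Vec Bool n)
allRows = allVecs (false ∷ true ∷ [])

allStaircases : ∀ n → List (Staircase n)
allStaircases zero    = [] ∷ []
allStaircases (suc n) = cartesianProductWith _∷_ (allRows n) (allStaircases n)

allVecs-complete : ∀ {xs : List A} → (∀ x → x ∈ xs) → (v : Vec A n) → v ∈ allVecs xs n
allVecs-complete c []      = here refl
allVecs-complete c (x ∷ v) = ∈.∈-cartesianProductWith⁺ _∷_ (c x) (allVecs-complete c v)

allVecs-unique : ∀ {xs : List A} → Unique xs → ∀ n → Unique (allVecs xs n)
allVecs-unique u zero    = [] ∷ []
allVecs-unique u (suc n) = Unique.cartesianProductWith⁺ _∷_ Vec.∷-injective u (allVecs-unique u n)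

allRows-complete : (r : Vec Bool n) → r ∈ allRows n
allRows-complete = allVecs-complete λ where
  false → here refl
  true  → there (here refl)

allRows-unique : ∀ n → Unique (allRows n)
allRows-unique = allVecs-unique (((λ ()) ∷ []) ∷ [] ∷ [])

allStaircases-complete : (s : Staircase n) → s ∈ allStaircases n
allStaircases-complete []      = here refl
allStaircases-complete (r ∷ s) =
  ∈.∈-cartesianProductWith⁺ _∷_ (allRows-complete r) (allStaircases-complete s)

allStaircases-unique : ∀ n → Unique (allStaircases n)
allStaircases-unique zero    = [] ∷ []
allStaircases-unique (suc n) =
  Unique.cartesianProductWith⁺ _∷_ ∷-injective (allRows-unique n) (allStaircases-unique n)

sumOver : List A → (A → ℕ) → ℕ
sumOver xs g = sum (map g xs)

syntax sumOver xs (λ x → e) = ∑[ x ∈ xs ] e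

sumOver-cong : ∀ (xs : List A) {g h : A → ℕ} → (∀ x → g x ≡ h x) → sumOver xs g ≡ sumOver xs h
sumOver-cong xs e = cong sum (List.map-cong e xs)

sumOver-0 : ∀ (xs : List A) → sumOver xs (λ _ → 0) ≡ 0
sumOver-0 []       = refl
sumOver-0 (x ∷ xs) = sumOver-0 xs

sumOver-cartesianProductWith : ∀ (f : A → B → C) xs ys g →
  sumOver (cartesianProductWith f xs ys) g ≡ ∑[ x ∈ xs ] ∑[ y ∈ ys ] g (f x y)
sumOver-cartesianProductWith f []       ys g = refl
sumOver-cartesianProductWith f (x ∷ xs) ys g = begin
  sum (map g (map (f x) ys ++ cartesianProductWith f xs ys))
    ≡⟨ cong sum (List.map-++ g (map (f x) ys) _) ⟩
  sum (map g (map (f x) ys) ++ map g (cartesianProductWith f xs ys))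
    ≡⟨ sum-++ (map g (map (f x) ys)) _ ⟩
  sum (map g (map (f x) ys)) + sumOver (cartesianProductWith f xs ys) g
    ≡⟨ cong₂ _+_ (cong sum (sym (List.map-∘ ys))) (sumOver-cartesianProductWith f xs ys g) ⟩
  sumOver (x ∷ xs) (λ x → ∑[ y ∈ ys ] g (f x y)) ∎
  where open ≡-Reasoning

sumOver-allRows : ∀ n (g : Vec Bool (suc n) → ℕ) →
  sumOver (allRows (suc n)) g ≡
  sumOver (allRows n) (g ∘ (false ∷_)) + sumOver (allRows n) (g ∘ (true ∷_))
sumOver-allRows n g = trans (sumOver-cartesianProductWith _∷_ (false ∷ true ∷ []) (allRows n) g)
  (cong (_+_ (sumOver (allRows n) (g ∘ (false ∷_)))) (+-identityʳ _))

length-filter-T : ∀ (p : A → Bool) xs →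
  length (filter (λ x → T? (p x)) xs) ≡ ∑[ x ∈ xs ] (if p x then 1 else 0)
length-filter-T p []       = refl
length-filter-T p (x ∷ xs) with p x
... | true  = cong suc (length-filter-T p xs)
... | false = length-filter-T p xs

sumOver-if : ∀ b (xs : List A) g →
  (∑[ x ∈ xs ] (if b then g x else 0)) ≡ (if b then sumOver xs g else 0)
sumOver-if true  xs g = refl
sumOver-if false xs g = sumOver-0 xs

-- Exactly one row is empty, and it satisfies `connectedRow` vacuously. This provides the cases in
-- which a vertex has one above it, so that nothing may stand to its left.
sumOver-emptyRow : ∀ (a : Vec Bool n) (g : Vec Bool n → ℕ) →
  (∑[ r ∈ allRows n ] (if not (nonempty r) ∧ connectedRow a r then g (zipWith _∨_ a r) else 0)) ≡ g a
sumOver-emptyRow []      g = +-identityʳ _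
sumOver-emptyRow {suc n} (x ∷ a) g = begin
  _ ≡⟨ sumOver-allRows n _ ⟩
  _ ≡⟨ cong₂ _+_ (sumOver-emptyRow a (λ b → g ((x ∨ false) ∷ b))) (sumOver-0 (allRows n)) ⟩
  g ((x ∨ false) ∷ a) + 0 ≡⟨ +-identityʳ _ ⟩
  g ((x ∨ false) ∷ a) ≡⟨ cong (λ y → g (y ∷ a)) (∨-identityʳ x) ⟩
  g (x ∷ a) ∎
  where open ≡-Reasoning

sumOver-nonemptyRows : ∀ (a : Vec Bool n) (g : Vec Bool n → ℕ) →
  (∑[ r ∈ allRows n ] (if nonempty r ∧ connectedRow a r then g (zipWith _∨_ a r) else 0)) ≡ rowSum a g
sumOver-nonemptyRows []          g = refl
sumOver-nonemptyRows {suc n} (true  ∷ a) g = trans (sumOver-allRows n _)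
  (cong₂ _+_ (sumOver-nonemptyRows a (g ∘ (true ∷_))) (sumOver-emptyRow a (g ∘ (true ∷_))))
sumOver-nonemptyRows {suc n} (false ∷ a) g = trans (sumOver-allRows n _)
  (cong₂ _+_ (sumOver-nonemptyRows a (g ∘ (false ∷_))) (sumOver-nonemptyRows a (g ∘ (true ∷_))))

leafRows : (Vec Bool n → Bool) → Vec Bool (suc n) → (Vec Bool n → ℕ) → ℕ
leafRows {n} q a g = ∑[ r ∈ allRows n ]
  (if q r ∧ connectedRow a (true ∷ r) then g (zipWith _∨_ (tail a) r) else 0)

leafRows-all : ∀ x (a : Vec Bool n) g →
  leafRows (λ _ → true) (x ∷ a) g ≡ (if x then g a else rowSum a g)
leafRows-all true  a g = sumOver-emptyRow a g
leafRows-all false a g = sumOver-nonemptyRows a g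

leafRows-undotted : ∀ (a : Vec Bool (suc n)) (g : ∀ {m} → Vec Bool m → ℕ) →
  leafRows (not ∘ dotted) a g ≡ undottedRowSum a g
leafRows-undotted (x ∷ [])        g = refl
leafRows-undotted {suc n} (x ∷ y ∷ a) g = begin
  _ ≡⟨ sumOver-allRows n _ ⟩
  _ ≡⟨ cong₂ _+_ refl (sumOver-0 (allRows n)) ⟩
  _ ≡⟨ +-identityʳ _ ⟩
  leafRows (λ _ → true) (x ∷ a) (λ b → g ((y ∨ false) ∷ b)) ≡⟨ leafRows-all x a _ ⟩
  _ ≡⟨ cong (λ z → if x then g (z ∷ a) else rowSum a (λ b → g (z ∷ b))) (∨-identityʳ y) ⟩
  _ ≡⟨ lemma x ⟩
  undottedRowSum (x ∷ y ∷ a) g ∎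
  where
  open ≡-Reasoning
  lemma : ∀ x → (if x then g (y ∷ a) else rowSum a (λ b → g (y ∷ b))) ≡ undottedRowSum (x ∷ y ∷ a) g
  lemma true  = refl
  lemma false = refl

leafRows-dotted : ∀ (a : Vec Bool (suc n)) (g : ∀ {m} → Vec Bool m → ℕ) →
  leafRows dotted a g ≡ dottedRowSum a g
leafRows-dotted (true  ∷ [])        g = +-identityʳ _
leafRows-dotted (false ∷ [])        g = refl
leafRows-dotted {suc n} (true  ∷ y ∷ a)     g = trans (sumOver-allRows n _)
  (cong₂ _+_ (sumOver-0 (allRows n)) (sumOver-0 (allRows n)))
leafRows-dotted {suc n} (false ∷ true  ∷ a) g = trans (sumOver-allRows n _)
  (cong₂ _+_ (sumOver-0 (allRows n)) (sumOver-emptyRow a (g ∘ (true ∷_))))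
leafRows-dotted {suc n} (false ∷ false ∷ a) g = trans (sumOver-allRows n _)
  (cong₂ _+_ (sumOver-0 (allRows n)) (sumOver-nonemptyRows a (g ∘ (true ∷_))))

count : (Staircase n → Bool) → Vec Bool n → ℕ
count {n} p a = ∑[ s ∈ allStaircases n ] (if p s ∧ connectedBelow a s then 1 else 0)

-- If `p` splits into a condition on the first row and one on the others, the latter are counted
-- separately for each first row.
count-∷ : ∀ (p : Staircase (suc n) → Bool) q p′ (a : Vec Bool (suc n)) →
  (∀ r s → p (r ∷ s) ≡ q r ∧ p′ s) → count p a ≡ leafRows q a (count p′)
count-∷ {n} p q p′ a e = trans (sumOver-cartesianProductWith _∷_ (allRows n) (allStaircases n) _)
  (sumOver-cong (allRows n) λ r →
    trans (sumOver-cong (allStaircases n) λ s → trans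
             (cong (λ b → if b ∧ connectedBelow a (r ∷ s) then 1 else 0) (e r s))
             (regroup (q r) (p′ s) (connectedRow a (true ∷ r)) _))
          (sumOver-if (q r ∧ connectedRow a (true ∷ r)) (allStaircases n) _))
  where
  regroup : ∀ b c d e → (if (b ∧ c) ∧ (d ∧ e) then 1 else 0) ≡
    (if b ∧ d then (if c ∧ e then 1 else 0) else 0)
  regroup false c     d     e = refl
  regroup true  c     true  e = refl
  regroup true  true  false e = refl
  regroup true  false false e = refl

leafRows-cong : ∀ q (a : Vec Bool (suc n)) {g h} → (∀ b → g b ≡ h b) → leafRows q a g ≡ leafRows q a h
leafRows-cong {n} q a e = sumOver-cong (allRows n) λ r →
  cong (λ z → if q r ∧ connectedRow a (true ∷ r) then z else 0) (e _)

count-all : ∀ (a : Vec Bool n) → count (λ _ → true) a ≡ fillings a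
count-all []      = refl
count-all (x ∷ a) = trans (count-∷ (λ _ → true) (λ _ → true) (λ _ → true) (x ∷ a) (λ _ _ → refl))
  (trans (leafRows-cong (λ _ → true) (x ∷ a) count-all) (trans (leafRows-all x a fillings) (lemma x)))
  where
  lemma : ∀ x → (if x then fillings a else rowSum a fillings) ≡ fillings (x ∷ a)
  lemma true  = refl
  lemma false = refl

count-startsAt : ∀ k (a : Vec Bool n) → count (startsAtᵇ k) a ≡ startingAt k a
count-startsAt zero    []        = refl
count-startsAt (suc k) []        = refl
count-startsAt zero    a@(_ ∷ _) = trans
  (count-∷ (startsAtᵇ 0) dotted (λ _ → true) a (λ r s → sym (∧-identityʳ _)))
  (trans (leafRows-cong dotted a count-all) (leafRows-dotted a fillings))
count-startsAt (suc k) a@(_ ∷ _) = trans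
  (count-∷ (startsAtᵇ (suc k)) (not ∘ dotted) (startsAtᵇ k) a (λ r s → refl))
  (trans (leafRows-cong (not ∘ dotted) a (count-startsAt k)) (leafRows-undotted a (startingAt k)))

-- Upper-diagonal CNMs are staircases

least : {P : Pred (Fin n) 0ℓ} → Decidable P → ∃ P →
  ∃ λ i → P i × (∀ j → P j → toℕ i ≤ toℕ j)
least {suc n} P? (i , p) with P? zero
... | yes p₀ = zero , p₀ , λ _ _ → z≤n
least {suc n} P? (zero  , p) | no ¬p₀ = contradiction p ¬p₀
least {suc n} P? (suc i , p) | no ¬p₀ with least (P? ∘ suc) (i , p)
... | k , pₖ , k≤ = suc k , pₖ , λ where
  zero    p₀ → contradiction p₀ ¬p₀
  (suc j) pⱼ → s≤s (k≤ j pⱼ)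

greatest : {P : Pred (Fin n) 0ℓ} → Decidable P → ∃ P →
  ∃ λ i → P i × (∀ j → P j → toℕ j ≤ toℕ i)
greatest {suc n} P? (i , p) with Fin.any? (P? ∘ suc)
... | yes ∃p with greatest (P? ∘ suc) ∃p
...   | k , pₖ , ≤k = suc k , pₖ , λ where
  zero    _  → z≤n
  (suc j) pⱼ → s≤s (≤k j pⱼ)
greatest {suc n} P? (zero  , p) | no ¬∃p = zero , p , λ where
  zero    _  → z≤n
  (suc j) pⱼ → contradiction (j , pⱼ) ¬∃p
greatest {suc n} P? (suc i , p) | no ¬∃p = contradiction (i , p) ¬∃p

record IsStaircaseCNM (M : Matrix n) : Set where
  field
    diagonal  : ∀ p → row p + col p ≡ suc n → Vertex M p
    bounded   : ∀ p → Vertex M p → row p + col p ≤ suc n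
    root      : ∃ λ p → IsRoot p × Vertex M p
    connected : ∀ p → Vertex M p → ¬ IsRoot p →
                ExactlyOne (∃ (Above M p)) (∃ (LeftOf M p))

position-injective : {p q : Position n} → row p ≡ row q → col p ≡ col q → p ≡ q
position-injective r c = cong₂ _,_ (Fin.toℕ-injective (suc-injective r)) (Fin.toℕ-injective (suc-injective c))

module _ {M : Matrix n} where

  -- Of two distinct vertices in the column below `q`, the upper one would be nearer to the lower
  -- one than `q` is. So a vertex is the nearest above at most one vertex.
  nearestAbove-unique : ∀ {p₁ p₂ q} → Vertex M p₁ → Vertex M p₂ →
    NearestAbove M p₁ q → NearestAbove M p₂ q → p₁ ≡ p₂
  nearestAbove-unique {p₁} {p₂} v₁ v₂ ((_ , c₁ , q<p₁) , max₁) ((_ , c₂ , q<p₂) , max₂)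
    with <-cmp (row p₁) (row p₂)
  ... | tri≈ _ e _ = position-injective e (trans (sym c₁) c₂)
  ... | tri< l _ _ = contradiction (max₂ p₁ (v₁ , trans (sym c₁) c₂ , l)) (<⇒≱ q<p₁)
  ... | tri> _ _ l = contradiction (max₁ p₂ (v₂ , trans (sym c₂) c₁ , l)) (<⇒≱ q<p₂)

  nearestLeft-unique : ∀ {p₁ p₂ q} → Vertex M p₁ → Vertex M p₂ →
    NearestLeft M p₁ q → NearestLeft M p₂ q → p₁ ≡ p₂
  nearestLeft-unique {p₁} {p₂} v₁ v₂ ((_ , r₁ , q<p₁) , max₁) ((_ , r₂ , q<p₂) , max₂)
    with <-cmp (col p₁) (col p₂)
  ... | tri≈ _ e _ = position-injective (trans (sym r₁) r₂) e
  ... | tri< l _ _ = contradiction (max₂ p₁ (v₁ , trans (sym r₁) r₂ , l)) (<⇒≱ q<p₁)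
  ... | tri> _ _ l = contradiction (max₁ p₂ (v₂ , trans (sym r₂) r₁ , l)) (<⇒≱ q<p₂)

  -- The last vertex of a row has children in its column only, hence at most one.
  upperDiagonal⇒staircase : IsUpperDiagonalCNM M → IsStaircaseCNM M
  upperDiagonal⇒staircase (cnm , leaves) = record
    { diagonal  = λ p e → proj₁ (from (leaves p) e)
    ; bounded   = bounded
    ; root      = root
    ; connected = connected
    }
    where
    open IsCNM cnm
    bounded : ∀ p → Vertex M p → row p + col p ≤ suc n
    bounded (i , j) v with greatest (λ j → vertex? M (i , j)) (j , v)
    -- The last vertex of the row turns out to be childless, so it is a leaf and lies on the
    -- antidiagonal; every other vertex of the row is to its left.
    ... | k , vₖ , last = ≤-trans (+-monoʳ-≤ (suc (toℕ i)) (s≤s (last j v)))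
                                  (≤-reflexive (to (leaves q) (vₖ , childless)))
      where
      q = i , k
      below : ∀ {p} → Parent M p q → NearestAbove M p q
      below (_ , _ , inj₁ above) = above
      below {i′ , j′} (v′ , _ , inj₂ (_ , (_ , e , k<j′) , _))
        with refl ← Fin.toℕ-injective (suc-injective e) =
        contradiction (last j′ v′) (<⇒≱ (s<s⁻¹ k<j′))
      childless : Childless M q
      childless with complete q vₖ
      ... | inj₁ c = c
      ... | inj₂ (p₁ , p₂ , p₁≢p₂ , children) = contradiction
        (nearestAbove-unique (proj₁ c₁) (proj₁ c₂) (below c₁) (below c₂)) p₁≢p₂
        where c₁ = from (children p₁) (inj₁ refl)
              c₂ = from (children p₂) (inj₂ refl)

  -- The children of a vertex inside the staircase are the next vertex to its right and the next one
  -- below; both exist because the antidiagonal meets its row and its column further on. A vertex on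
  -- the antidiagonal is childless because row plus column increases from parent to child.
  staircase⇒upperDiagonal : IsStaircaseCNM M → IsUpperDiagonalCNM M
  staircase⇒upperDiagonal st = cnm , leaves
    where
    open IsStaircaseCNM st

    opposite-diagonal : ∀ (i : Fin n) → suc (toℕ i) + suc (toℕ (Fin.opposite i)) ≡ suc n
    opposite-diagonal i = trans (cong (_+_ (suc (toℕ i))) (trans (cong suc (Fin.opposite-prop i))
      (sym (+-∸-assoc 1 (Fin.toℕ<n i))))) (m+[n∸m]≡n (≤-trans (Fin.toℕ<n i) (n≤1+n n)))

    rows : ∀ i → Vertex M (i , Fin.opposite i)
    rows i = diagonal (i , Fin.opposite i) (opposite-diagonal i)

    columns : ∀ j → Vertex M (Fin.opposite j , j)
    columns j = diagonal (Fin.opposite j , j)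
      (trans (+-comm (suc (toℕ (Fin.opposite j))) _) (opposite-diagonal j))

    parent-< : ∀ {p q} → Parent M p q → row q + col q < row p + col p
    parent-< {p} {q} (_ , _ , inj₁ ((_ , e , l) , _)) =
      subst (λ c → row q + c < row p + col p) (sym e) (+-monoˡ-< (col p) l)
    parent-< {p} {q} (_ , _ , inj₂ (_ , (_ , e , l) , _)) =
      subst (λ r → r + col q < row p + col p) (sym e) (+-monoʳ-< (row p) l)

    diagonal-childless : ∀ p → row p + col p ≡ suc n → Childless M p
    diagonal-childless p e (c , par) =
      <⇒≱ (subst (_< row c + col c) e (parent-< par)) (bounded c (proj₁ par))

    right-child : ∀ p → Vertex M p → row p + col p < suc n →
      ∃ λ c → Parent M c p × NearestLeft M c p
    right-child p@(i , j) v inside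
      with least (λ k → vertex? M (i , k) ×-dec (j Fin.<? k))
                 (Fin.opposite i , rows i , s<s⁻¹ (+-cancelˡ-< (suc (toℕ i)) _ _
                   (subst (row p + col p <_) (sym (opposite-diagonal i)) inside)))
    ... | k , (vₖ , j<k) , first = c , (vₖ , notRoot , inj₂ (notBelow , nearest)) , nearest
      where
      c = i , k
      left : LeftOf M c p
      left = v , refl , s<s j<k
      nearest : NearestLeft M c p
      nearest = left , λ q (v′ , e , l) → ≮⇒≥ λ j<q → <⇒≱ (s<s⁻¹ l)
        (first (proj₂ q) (subst (Vertex M) (position-injective e refl) v′ , s<s⁻¹ j<q))
      notRoot : ¬ IsRoot c
      notRoot (_ , e) = <⇒≱ (≤-<-trans z≤n j<k) (≤-reflexive (suc-injective e))
      -- A vertex above takes precedence as the parent. There is none above `c`, since `c` already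
      -- has `p` to its left.
      notBelow : ¬ ∃ (Above M c)
      notBelow above with connected c vₖ notRoot
      ... | inj₁ (_ , ¬left) = ¬left (p , left)
      ... | inj₂ (¬above , _) = ¬above above

    lower-child : ∀ p → Vertex M p → row p + col p < suc n →
      ∃ λ c → Parent M c p × NearestAbove M c p
    lower-child p@(i , j) v inside
      with least (λ k → vertex? M (k , j) ×-dec (i Fin.<? k))
                 (Fin.opposite j , columns j , s<s⁻¹ (+-cancelˡ-< (suc (toℕ j)) _ _
                   (subst₂ _<_ (+-comm (row p) (col p)) (sym (opposite-diagonal j)) inside)))
    ... | k , (vₖ , i<k) , first = c , (vₖ , notRoot , inj₁ nearest) , nearest
      where
      c = k , j
      nearest : NearestAbove M c p
      nearest = (v , refl , s<s i<k) , λ q (v′ , e , l) → ≮⇒≥ λ i<q → <⇒≱ (s<s⁻¹ l)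
        (first (proj₁ q) (subst (Vertex M) (position-injective refl e) v′ , s<s⁻¹ i<q))
      notRoot : ¬ IsRoot c
      notRoot (e , _) = <⇒≱ (≤-<-trans z≤n i<k) (≤-reflexive (suc-injective e))

    complete : ∀ p → Vertex M p → Childless M p ⊎ TwoChildren M p
    complete p v with m≤n⇒m<n∨m≡n (bounded p v)
    ... | inj₂ e = inj₁ (diagonal-childless p e)
    ... | inj₁ inside with right-child p v inside | lower-child p v inside
    ...   | c , parᶜ , nearᶜ | d , parᵈ , nearᵈ = inj₂ (c , d , c≢d , λ q → mk⇔ (child q) λ where
        (inj₁ refl) → parᶜ
        (inj₂ refl) → parᵈ)
      where
      c≢d : c ≢ d
      c≢d refl = <-irrefl (proj₁ (proj₂ (proj₁ nearᶜ))) (proj₂ (proj₂ (proj₁ nearᵈ)))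
      child : ∀ q → Parent M q p → q ≡ c ⊎ q ≡ d
      child q (v′ , _ , inj₁ near)       = inj₂ (nearestAbove-unique v′ (proj₁ parᵈ) near nearᵈ)
      child q (v′ , _ , inj₂ (_ , near)) = inj₁ (nearestLeft-unique v′ (proj₁ parᶜ) near nearᶜ)

    cnm : IsCNM M
    cnm = record
      { root      = root
      ; connected = connected
      ; rows      = λ i → _ , rows i
      ; columns   = λ j → _ , columns j
      ; complete  = complete
      }

    leaves : ∀ p → Leaf M p ⇔ row p + col p ≡ suc n
    leaves p = mk⇔
      (λ (v , childless) → [ (λ inside → let c , par , _ = lower-child p v inside
                                         in contradiction (c , par) childless) , id ]′
                           (m≤n⇒m<n∨m≡n (bounded p v)))
      (λ e → diagonal p e , diagonal-childless p e)

-- Correctness of the Boolean conditions on staircases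

exactlyOne-cong : A ⇔ A′ → B ⇔ B′ → ExactlyOne A B → ExactlyOne A′ B′
exactlyOne-cong e e′ = Sum.map (λ (a , ¬b) → to e a , ¬b ∘ from e′)
                               (λ (¬a , b) → ¬a ∘ from e , to e′ b)

xor⇔exactlyOne : ∀ x y → T (x xor y) ⇔ ExactlyOne (T x) (T y)
xor⇔exactlyOne true  true  = mk⇔ (λ ()) [ (λ (_ , ¬y) → ¬y tt) , (λ (¬x , _) → ¬x tt) ]′
xor⇔exactlyOne true  false = mk⇔ (λ _ → inj₁ (tt , id)) _
xor⇔exactlyOne false true  = mk⇔ (λ _ → inj₂ (id , tt)) _
xor⇔exactlyOne false false = mk⇔ (λ ()) [ proj₁ , proj₂ ]′

-- Columns are numbered from 0 at the left, so the head of a vector of length `suc n` is column `n`.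
-- These numbers do not change when the leaf column is dropped from the front.
data Dot : ℕ → Vec Bool n → Set where
  here  : ∀ {r : Vec Bool n} → Dot n (true ∷ r)
  there : ∀ {j x} {r : Vec Bool n} → Dot j r → Dot j (x ∷ r)

dot-< : ∀ {j} {r : Vec Bool n} → Dot j r → j < n
dot-< here      = n<1+n _
dot-< (there d) = m<n⇒m<1+n (dot-< d)

dot-head : ∀ {x} {r : Vec Bool n} → Dot n (x ∷ r) ⇔ T x
dot-head {x = true}  = mk⇔ _ (λ _ → here)
dot-head {x = false} = mk⇔ (λ { (there d) → <-irrefl refl (dot-< d) }) (λ ())

dot-tail : ∀ {j x} {r : Vec Bool n} → j < n → Dot j (x ∷ r) ⇔ Dot j r
dot-tail j<n = mk⇔ (λ { here → contradiction j<n (<-irrefl refl) ; (there d) → d }) there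

dot? : ∀ j (r : Vec Bool n) → Dec (Dot j r)
dot? j [] = no λ ()
dot? {suc n} j (x ∷ r) with dot? j r | j ≟ n
... | yes d | _        = yes (there d)
... | no ¬d | no j≢n   = no λ { here → j≢n refl ; (there d) → ¬d d }
dot? {suc n} j (true  ∷ r) | no ¬d | yes refl = yes here
dot? {suc n} j (false ∷ r) | no ¬d | yes refl = no λ { (there d) → ¬d d }

dot-∨ : ∀ {j} (a r : Vec Bool n) → Dot j (zipWith _∨_ a r) ⇔ (Dot j a ⊎ Dot j r)
dot-∨ a r = mk⇔ (split a r) (λ { (inj₁ d) → left a r d ; (inj₂ d) → right a r d })
  where
  split : ∀ {n j} (a r : Vec Bool n) → Dot j (zipWith _∨_ a r) → Dot j a ⊎ Dot j r
  split (true  ∷ a) (_    ∷ r) here      = inj₁ here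
  split (false ∷ a) (true ∷ r) here      = inj₂ here
  split (_     ∷ a) (_    ∷ r) (there d) = Sum.map there there (split a r d)
  left : ∀ {n j} (a r : Vec Bool n) → Dot j a → Dot j (zipWith _∨_ a r)
  left (_ ∷ a) (_ ∷ r) here      = here
  left (_ ∷ a) (_ ∷ r) (there d) = there (left a r d)
  right : ∀ {n j} (a r : Vec Bool n) → Dot j r → Dot j (zipWith _∨_ a r)
  right (true  ∷ a) (_ ∷ r) here      = here
  right (false ∷ a) (_ ∷ r) here      = here
  right (_     ∷ a) (_ ∷ r) (there d) = there (right a r d)

nonempty⇔dot : ∀ (r : Vec Bool n) → T (nonempty r) ⇔ ∃ λ j → Dot j r
nonempty⇔dot []          = mk⇔ (λ ()) (λ ())
nonempty⇔dot (true  ∷ r) = mk⇔ (λ _ → _ , here) _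
nonempty⇔dot (false ∷ r) = mk⇔ (map₂ there ∘ to (nonempty⇔dot r))
                               (λ { (j , there d) → from (nonempty⇔dot r) (j , d) })

ConnectedRow : (Above : ℕ → Set) → Vec Bool n → Set
ConnectedRow Above r = ∀ j → Dot j r → ExactlyOne (Above j) (∃ λ j′ → j′ < j × Dot j′ r)

connectedRow⇔ : ∀ (a r : Vec Bool n) → T (connectedRow a r) ⇔ ConnectedRow (λ j → Dot j a) r
connectedRow⇔ []      []      = mk⇔ (λ _ _ ()) _
connectedRow⇔ {suc n} (x ∷ a) (y ∷ r) = mk⇔ (sound y) (complete y)
  where
  above : ∀ {j} → j < n → Dot j a ⇔ Dot j (x ∷ a)
  above j<n = mk⇔ (from (dot-tail j<n)) (to (dot-tail j<n))
  left : ∀ {y j} → j < n → (∃ λ j′ → j′ < j × Dot j′ r) ⇔ (∃ λ j′ → j′ < j × Dot j′ (y ∷ r))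
  left j<n = mk⇔ (map₂ (λ (l , d) → l , there d))
                 (map₂ (λ (l , d) → l , to (dot-tail (<-trans l j<n)) d))
  last : ∀ {y} → T (nonempty r) ⇔ ∃ λ j → j < n × Dot j (y ∷ r)
  last = mk⇔ (map₂ (λ d → dot-< d , there d) ∘ to (nonempty⇔dot r))
             (λ (j , l , d) → from (nonempty⇔dot r) (j , to (dot-tail l) d))
  tails : ∀ {y} → T (connectedRow a r) → ∀ {j} → Dot j r →
    ExactlyOne (Dot j (x ∷ a)) (∃ λ j′ → j′ < j × Dot j′ (y ∷ r))
  tails t d = exactlyOne-cong (above (dot-< d)) (left (dot-< d)) (to (connectedRow⇔ a r) t _ d)
  untails : ∀ {y} → ConnectedRow (λ j → Dot j (x ∷ a)) (y ∷ r) → T (connectedRow a r)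
  untails c = from (connectedRow⇔ a r) λ j d →
    exactlyOne-cong (⇔-sym (above (dot-< d))) (⇔-sym (left (dot-< d))) (c j (there d))
  sound : ∀ y → T (connectedRow (x ∷ a) (y ∷ r)) → ConnectedRow (λ j → Dot j (x ∷ a)) (y ∷ r)
  sound true  t j here = exactlyOne-cong (⇔-sym dot-head) last
    (to (xor⇔exactlyOne x (nonempty r)) (proj₁ (to T-∧ t)))
  sound true  t j (there d) = tails (proj₂ (to (T-∧ {x xor nonempty r}) t)) d
  sound false t j (there d) = tails t d
  complete : ∀ y → ConnectedRow (λ j → Dot j (x ∷ a)) (y ∷ r) → T (connectedRow (x ∷ a) (y ∷ r))
  complete true  c = from T-∧
    ( from (xor⇔exactlyOne x (nonempty r)) (exactlyOne-cong dot-head (⇔-sym last) (c n here))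
    , untails c)
  complete false c = untails c

Cell : Staircase n → ℕ → ℕ → Set
Cell []      _       _ = ⊥
Cell (r ∷ s) zero    j = Dot j (true ∷ r)
Cell (r ∷ s) (suc i) j = Cell s i j

cell? : ∀ (s : Staircase n) i j → Dec (Cell s i j)
cell? []      _       _ = no λ ()
cell? (r ∷ s) zero    j = dot? j (true ∷ r)
cell? (r ∷ s) (suc i) j = cell? s i j

cell-bounded : ∀ (s : Staircase n) {i j} → Cell s i j → i + j < n
cell-bounded (r ∷ s) {zero}  c = dot-< c
cell-bounded (r ∷ s) {suc i} c = s<s (cell-bounded s c)

cell-diagonal : ∀ (s : Staircase n) {i j} → suc (i + j) ≡ n → Cell s i j
cell-diagonal (r ∷ s) {zero}  refl = here
cell-diagonal (r ∷ s) {suc i} refl = cell-diagonal s refl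

cell-row : ∀ (s : Staircase n) {i j} → Cell s i j → i < n
cell-row s c = ≤-<-trans (m≤m+n _ _) (cell-bounded s c)

cell-col : ∀ (s : Staircase n) {i j} → Cell s i j → j < n
cell-col s {i} c = ≤-<-trans (m≤n+m _ i) (cell-bounded s c)

CellAbove CellLeft : Staircase n → ℕ → ℕ → Set
CellAbove s i j = ∃ λ i′ → i′ < i × Cell s i′ j
CellLeft  s i j = ∃ λ j′ → j′ < j × Cell s i j′

ConnectedBelow : Vec Bool n → Staircase n → Set
ConnectedBelow a s = ∀ i j → Cell s i j → ExactlyOne (Dot j a ⊎ CellAbove s i j) (CellLeft s i j)

-- For the later rows, a vertex above the first row or in it is recorded in the single vector `a′`.
-- Dropping column `n` loses nothing, because all later cells lie in columns below `n`.
connectedBelow⇔ : ∀ (a : Vec Bool n) s → T (connectedBelow a s) ⇔ ConnectedBelow a s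
connectedBelow⇔ a [] = mk⇔ (λ _ _ _ ()) _
connectedBelow⇔ {suc n} (x ∷ a) (r ∷ s) = mk⇔ sound complete
  where
  a′ = zipWith _∨_ a r
  above₀ : ∀ {j} → Dot j (x ∷ a) ⇔ (Dot j (x ∷ a) ⊎ CellAbove (r ∷ s) 0 j)
  above₀ = mk⇔ inj₁ λ { (inj₁ d) → d ; (inj₂ (_ , () , _)) }
  above₁ : ∀ {i j} → j < n → (Dot j a′ ⊎ CellAbove s i j) ⇔ (Dot j (x ∷ a) ⊎ CellAbove (r ∷ s) (suc i) j)
  above₁ j<n = mk⇔
    (λ where
      (inj₁ d) → Sum.map there (λ d → 0 , z<s , there d) (to (dot-∨ a r) d)
      (inj₂ (i′ , l , c)) → inj₂ (suc i′ , s<s l , c))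
    (λ where
      (inj₁ d) → inj₁ (from (dot-∨ a r) (inj₁ (to (dot-tail j<n) d)))
      (inj₂ (zero   , _ , d)) → inj₁ (from (dot-∨ a r) (inj₂ (to (dot-tail j<n) d)))
      (inj₂ (suc i′ , l , c)) → inj₂ (i′ , s<s⁻¹ l , c))
  sound : T (connectedBelow (x ∷ a) (r ∷ s)) → ConnectedBelow (x ∷ a) (r ∷ s)
  sound t zero    j c = exactlyOne-cong above₀ (⇔-id _)
    (to (connectedRow⇔ (x ∷ a) (true ∷ r)) (proj₁ (to T-∧ t)) j c)
  sound t (suc i) j c = exactlyOne-cong (above₁ (cell-col s c)) (⇔-id _)
    (to (connectedBelow⇔ a′ s) (proj₂ (to (T-∧ {connectedRow (x ∷ a) (true ∷ r)}) t)) i j c)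
  complete : ConnectedBelow (x ∷ a) (r ∷ s) → T (connectedBelow (x ∷ a) (r ∷ s))
  complete C = from T-∧
    ( from (connectedRow⇔ (x ∷ a) (true ∷ r)) (λ j c → exactlyOne-cong (⇔-sym above₀) (⇔-id _) (C 0 j c))
    , from (connectedBelow⇔ a′ s) (λ i j c →
        exactlyOne-cong (⇔-sym (above₁ (cell-col s c))) (⇔-id _) (C (suc i) j c)))

-- Indices start at 0 here, so the entry to the left of the leaf of a row satisfies
-- `suc (suc (i + j)) ≡ n`.
FirstDot : ℕ → Staircase n → Set
FirstDot {n} k s =
  (∀ i j → suc (suc (i + j)) ≡ n → i < k → ¬ Cell s i j) ×
  ((∃ λ j → suc (suc (k + j)) ≡ n × Cell s k j) ⊎ suc k ≡ n)

startsAtᵇ⇔ : ∀ k (s : Staircase n) → T (startsAtᵇ k s) ⇔ FirstDot k s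
startsAtᵇ⇔ k       []            = mk⇔ (λ ()) λ { (_ , inj₁ (_ , () , _)) ; (_ , inj₂ ()) }
-- This is the last row, which counts as dotted: the alternative `suc k ≡ n`.
startsAtᵇ⇔ zero    ([] ∷ s)      = mk⇔ (λ _ → (λ _ _ _ ()) , inj₂ refl) _
startsAtᵇ⇔ zero    ((x ∷ r) ∷ s) = mk⇔
  (λ t → (λ _ _ _ ()) , inj₁ (_ , refl , there (from dot-head t)))
  (λ { (_ , inj₁ (_ , refl , d)) → to dot-head (to (dot-tail (n<1+n _)) d) })
startsAtᵇ⇔ (suc k) ([] ∷ [])     = mk⇔ (λ ()) λ { (_ , inj₁ (_ , () , _)) ; (_ , inj₂ ()) }
startsAtᵇ⇔ (suc k) ((x ∷ r) ∷ s) = mk⇔ (sound x) (complete x)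
  where
  sound : ∀ x → T (not x ∧ startsAtᵇ k s) → FirstDot (suc k) ((x ∷ r) ∷ s)
  sound false t with to (startsAtᵇ⇔ k s) t
  ... | zeros , dot = zeros′ ,
    Sum.map (map₂ (λ (e , c) → cong suc e , c)) (cong suc) dot
    where
    zeros′ : ∀ i j → suc (suc (i + j)) ≡ _ → i < suc k → ¬ Cell ((false ∷ r) ∷ s) i j
    zeros′ zero    j refl _ c = to dot-head (to (dot-tail (n<1+n _)) c)
    zeros′ (suc i) j e    l c = zeros i j (suc-injective e) (s<s⁻¹ l) c
  complete : ∀ x → FirstDot (suc k) ((x ∷ r) ∷ s) → T (not x ∧ startsAtᵇ k s)
  complete true  (zeros , _)   = zeros 0 _ refl z<s (there here)
  complete false (zeros , dot) = from (startsAtᵇ⇔ k s)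
    ( (λ i j e l → zeros (suc i) j (cong suc e) (s<s l))
    , Sum.map (map₂ (λ (e , c) → suc-injective e , c)) suc-injective dot)

dot-ext : ∀ (r r′ : Vec Bool n) → (∀ j → Dot j r ⇔ Dot j r′) → r ≡ r′
dot-ext []      []        e = refl
dot-ext {suc n} (x ∷ r) (x′ ∷ r′) e = cong₂ _∷_
  (heads x x′ (λ t → to dot-head (to (e n) (from dot-head t)))
              (λ t → to dot-head (from (e n) (from dot-head t))))
  (dot-ext r r′ λ j → mk⇔
    (λ d → to (dot-tail (dot-< d)) (to (e j) (there d)))
    (λ d → to (dot-tail (dot-< d)) (from (e j) (there d))))
  where
  heads : ∀ x y → (T x → T y) → (T y → T x) → x ≡ y
  heads true  true  _ _ = refl
  heads true  false f _ = ⊥-elim (f tt)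
  heads false true  _ g = ⊥-elim (g tt)
  heads false false _ _ = refl

cell-ext : ∀ (s s′ : Staircase n) → (∀ i j → Cell s i j ⇔ Cell s′ i j) → s ≡ s′
cell-ext []      []        e = refl
cell-ext (r ∷ s) (r′ ∷ s′) e = cong₂ _∷_
  (dot-ext r r′ λ j → mk⇔
    (λ d → to (dot-tail (dot-< d)) (to (e 0 j) (there d)))
    (λ d → to (dot-tail (dot-< d)) (from (e 0 j) (there d))))
  (cell-ext s s′ (λ i j → e (suc i) j))

-- Staircases as matrices

module _ {V : Pred ℕ 0ℓ} (V? : Decidable V) where

  fromRow : ∀ n → Vec Bool n
  fromRow zero    = []
  fromRow (suc n) = does (V? n) ∷ fromRow n

  dot-fromRow⁻ : ∀ n {j} → Dot j (fromRow n) → V j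
  dot-fromRow⁻ (suc n) d with V? n
  dot-fromRow⁻ (suc n) here      | yes v = v
  dot-fromRow⁻ (suc n) (there d) | _     = dot-fromRow⁻ n d

  dot-fromRow⁺ : ∀ n {j} → j < n → V j → Dot j (fromRow n)
  dot-fromRow⁺ (suc n) {j} j<1+n v with m≤n⇒m<n∨m≡n (s≤s⁻¹ j<1+n)
  ... | inj₁ j<n  = there (dot-fromRow⁺ n j<n v)
  ... | inj₂ refl rewrite dec-true (V? n) v = here

fromCells : ∀ n {V : ℕ → ℕ → Set} → (∀ i j → Dec (V i j)) → Staircase n
fromCells zero    V? = []
fromCells (suc n) V? = fromRow (V? 0) n ∷ fromCells n (λ i j → V? (suc i) j)

-- A staircase has its antidiagonal built in, whatever `V` says there; hence the hypothesis on
-- `suc (i + j) ≡ n`.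
cell-fromCells⁻ : ∀ n {V : ℕ → ℕ → Set} (V? : ∀ i j → Dec (V i j)) i {j} →
  (suc (i + j) ≡ n → V i j) → Cell (fromCells n V?) i j → V i j
cell-fromCells⁻ (suc n) V? zero    diag here      = diag refl
cell-fromCells⁻ (suc n) V? zero    diag (there d) = dot-fromRow⁻ (V? 0) n d
cell-fromCells⁻ (suc n) V? (suc i) diag c         =
  cell-fromCells⁻ n (λ i j → V? (suc i) j) i (diag ∘ cong suc) c

cell-fromCells⁺ : ∀ n {V : ℕ → ℕ → Set} (V? : ∀ i j → Dec (V i j)) i {j} →
  i + j < n → V i j → Cell (fromCells n V?) i j
cell-fromCells⁺ (suc n) V? zero    l v with m≤n⇒m<n∨m≡n (s≤s⁻¹ l)
... | inj₁ j<n  = there (dot-fromRow⁺ (V? 0) n j<n v)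
... | inj₂ refl = here
cell-fromCells⁺ (suc n) V? (suc i) l v =
  cell-fromCells⁺ n (λ i j → V? (suc i) j) i (s<s⁻¹ l) v

toMatrix : Staircase n → Matrix n
toMatrix s = tabulate λ i → tabulate λ j → does (cell? s (toℕ i) (toℕ j))

vertex⇔cell : ∀ (s : Staircase n) i j → Vertex (toMatrix s) (i , j) ⇔ Cell s (toℕ i) (toℕ j)
vertex⇔cell s i j = mk⇔
  (λ v → witness (cell? s (toℕ i) (toℕ j)) (trans (sym entry) v))
  (λ c → trans entry (dec-true (cell? s (toℕ i) (toℕ j)) c))
  where
  entry : lookup (lookup (toMatrix s) i) j ≡ does (cell? s (toℕ i) (toℕ j))
  entry = trans (cong (λ r → lookup r j) (Vec.lookup∘tabulate _ i)) (Vec.lookup∘tabulate _ j)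
  witness : {A : Set} (a? : Dec A) → does a? ≡ true → A
  witness (yes a) _ = a

vertex-ext : ∀ (M N : Matrix n) → (∀ p → Vertex M p ⇔ Vertex N p) → M ≡ N
vertex-ext M N e = trans (sym (rebuild M)) (trans
  (Vec.tabulate-cong λ i → Vec.tabulate-cong λ j → ⇔→≡ (e (i , j))) (rebuild N))
  where
  rebuild : ∀ M → tabulate (λ i → tabulate (lookup (lookup M i))) ≡ M
  rebuild M = trans (Vec.tabulate-cong λ i → Vec.tabulate∘lookup (lookup M i)) (Vec.tabulate∘lookup M)

toPosition : ∀ {i j} → i < n → j < n → ∃ λ (p : Position n) → toℕ (proj₁ p) ≡ i × toℕ (proj₂ p) ≡ j
toPosition i<n j<n = (fromℕ< i<n , fromℕ< j<n) , Fin.toℕ-fromℕ< i<n , Fin.toℕ-fromℕ< j<n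

toMatrix-injective : ∀ {s s′ : Staircase n} → toMatrix s ≡ toMatrix s′ → s ≡ s′
toMatrix-injective {n} {s} {s′} e = cell-ext s s′ λ i j → mk⇔ (half s s′ e) (half s′ s (sym e))
  where
  half : ∀ (s s′ : Staircase n) → toMatrix s ≡ toMatrix s′ → ∀ {i j} → Cell s i j → Cell s′ i j
  half s s′ e c with (p , refl , refl) ← toPosition (cell-row s c) (cell-col s c) =
    to (vertex⇔cell s′ _ _) (subst (λ M → Vertex M p) e (from (vertex⇔cell s _ _) c))

-- The staircase is read off from `M`. By `bounded` no vertex is lost beyond the antidiagonal, and
-- by `diagonal` the built-in antidiagonal adds none.
toMatrix-surjective : ∀ {M : Matrix n} → IsStaircaseCNM M → ∃ λ s → toMatrix s ≡ M
toMatrix-surjective {n} {M} st = s , vertex-ext (toMatrix s) M λ (i , j) → mk⇔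
  (λ v → let v′ = to (vertex⇔cell s i j) v in occupied⁻ (cell-fromCells⁻ n V? (toℕ i)
     (λ e → (i , j) , refl , refl , diagonal (i , j) (trans (cong suc (+-suc _ _)) (cong suc e))) v′))
  (λ v → from (vertex⇔cell s i j) (cell-fromCells⁺ n V? (toℕ i)
     (s≤s⁻¹ (≤-trans (≤-reflexive (cong suc (sym (+-suc _ _)))) (bounded (i , j) v)))
     ((i , j) , refl , refl , v)))
  where
  open IsStaircaseCNM st
  -- Vertices are addressed by natural numbers, since `fromCells` shifts the row index at each step.
  Occupied : ℕ → ℕ → Set
  Occupied i j = ∃ λ p → row p ≡ suc i × col p ≡ suc j × Vertex M p
  V? : ∀ i j → Dec (Occupied i j)
  V? i j = any? λ p → (row p ≟ suc i) ×-dec (col p ≟ suc j) ×-dec vertex? M p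
  s = fromCells n V?
  occupied⁻ : ∀ {i j} → Occupied (toℕ i) (toℕ j) → Vertex M (i , j)
  occupied⁻ (p , r , c , v) = subst (Vertex M) (position-injective r c) v

startsAt⇔ : ∀ k (s : Staircase n) → StartsAt k (toMatrix s) ⇔ FirstDot k s
startsAt⇔ {n} k s = mk⇔
  (λ (zeros , dot) →
    (λ i j e l c → let (p , eᵢ , eⱼ) = toPosition (cell-row s c) (cell-col s c) in
      zeros p (trans (cong₂ _+_ (cong suc eᵢ) (cong suc eⱼ)) (trans (cong suc (+-suc i j)) e))
              (subst (_< k) (sym eᵢ) l)
              (from (vertex⇔cell s _ _) (subst₂ (Cell s) (sym eᵢ) (sym eⱼ) c)))
    , Sum.map₁ (λ { ((i , j) , refl , e , v) →
        toℕ j , trans (cong suc (sym (+-suc _ _))) e , to (vertex⇔cell s i j) v }) dot)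
  (λ (zeros , dot) →
    (λ (i , j) e l v → zeros (toℕ i) (toℕ j) (trans (cong suc (sym (+-suc _ _))) e) l
                             (to (vertex⇔cell s i j) v))
    , Sum.map₁ (λ (j , e , c) → let (p , eᵢ , eⱼ) = toPosition (cell-row s c) (cell-col s c) in
        p , cong suc eᵢ , trans (cong₂ _+_ (cong suc eᵢ) (cong suc eⱼ)) (trans (cong suc (+-suc k j)) e)
          , from (vertex⇔cell s _ _) (subst₂ (Cell s) (sym eᵢ) (sym eⱼ) c)) dot)

-- The vector with which the recursion starts above the first row. The leftmost column is stored
-- last.
firstColumn : ∀ n → Vec Bool (suc n)
firstColumn zero    = true ∷ []
firstColumn (suc n) = false ∷ firstColumn n

dot-firstColumn : ∀ n {j} → Dot j (firstColumn n) ⇔ j ≡ 0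
dot-firstColumn n = mk⇔ (first n) (λ { refl → zeroth n })
  where
  first : ∀ n {j} → Dot j (firstColumn n) → j ≡ 0
  first zero    here      = refl
  first (suc n) (there d) = first n d
  zeroth : ∀ n → Dot 0 (firstColumn n)
  zeroth zero    = here
  zeroth (suc n) = there (zeroth n)

above⇔ : ∀ (s : Staircase n) i j → ∃ (Above (toMatrix s) (i , j)) ⇔ CellAbove s (toℕ i) (toℕ j)
above⇔ s i j = mk⇔
  (λ ((i′ , j′) , v , e , l) → toℕ i′ , s<s⁻¹ l ,
     subst (Cell s (toℕ i′)) (suc-injective e) (to (vertex⇔cell s i′ j′) v))
  (λ (i′ , l , c) → let (p , eᵢ , eⱼ) = toPosition (cell-row s c) (cell-col s c) in
     p , from (vertex⇔cell s _ _) (subst₂ (Cell s) (sym eᵢ) (sym eⱼ) c)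
       , cong suc eⱼ , s<s (subst (_< toℕ i) (sym eᵢ) l))

leftOf⇔ : ∀ (s : Staircase n) i j → ∃ (LeftOf (toMatrix s) (i , j)) ⇔ CellLeft s (toℕ i) (toℕ j)
leftOf⇔ s i j = mk⇔
  (λ ((i′ , j′) , v , e , l) → toℕ j′ , s<s⁻¹ l ,
     subst (λ i → Cell s i (toℕ j′)) (suc-injective e) (to (vertex⇔cell s i′ j′) v))
  (λ (j′ , l , c) → let (p , eᵢ , eⱼ) = toPosition (cell-row s c) (cell-col s c) in
     p , from (vertex⇔cell s _ _) (subst₂ (Cell s) (sym eᵢ) (sym eⱼ) c)
       , cong suc eᵢ , s<s (subst (_< toℕ j) (sym eⱼ) l))

-- The root gets a virtual vertex above it, so that it needs no special treatment.
staircaseCNM⇔ : ∀ (s : Staircase (suc n)) →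
  IsStaircaseCNM (toMatrix s) ⇔ ConnectedBelow (firstColumn n) s
staircaseCNM⇔ {n} s = mk⇔ sound complete
  where
  -- In the first row only column 0 counts as occupied above. Any other vertex there has one to its
  -- left, and the descent from the leaf ends at the root.
  root-cell : ConnectedBelow (firstColumn n) s → ∀ j → Cell s 0 j → Cell s 0 0
  root-cell C = <-rec _ λ j rec c → case j rec c (C 0 j c)
    where
    case : ∀ j → (∀ {j′} → j′ < j → Cell s 0 j′ → Cell s 0 0) → Cell s 0 j →
      ExactlyOne (Dot j (firstColumn n) ⊎ CellAbove s 0 j) (CellLeft s 0 j) → Cell s 0 0
    case j rec c (inj₁ (inj₁ d , _)) = subst (Cell s 0) (to (dot-firstColumn n) d) c
    case j rec c (inj₂ (_ , j′ , l , c′)) = rec l c′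

  sound : IsStaircaseCNM (toMatrix s) → ConnectedBelow (firstColumn n) s
  sound st i j c with toPosition (cell-row s c) (cell-col s c)
  ... | p@(i₀ , j₀) , refl , refl with isRoot? (toMatrix s) p
  ...   | yes (_ , e) = inj₁ (inj₁ (from (dot-firstColumn n) (suc-injective e)) ,
                              λ (j′ , l , _) → n≮0 (subst (j′ <_) (suc-injective e) l))
  ...   | no ¬root with IsStaircaseCNM.connected st p (from (vertex⇔cell s i₀ j₀) c) ¬root
  ...     | inj₁ (above , ¬left) = inj₁ (inj₂ (to (above⇔ s i₀ j₀) above) , ¬left ∘ from (leftOf⇔ s i₀ j₀))
  ...     | inj₂ (¬above , left) = inj₂ (¬below , to (leftOf⇔ s i₀ j₀) left)
    where
    -- The virtual vertex cannot compete with a vertex to the left, because it lies over column 0.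
    ¬below : ¬ (Dot (toℕ j₀) (firstColumn n) ⊎ CellAbove s (toℕ i₀) (toℕ j₀))
    ¬below (inj₂ a) = ¬above (from (above⇔ s i₀ j₀) a)
    ¬below (inj₁ d) = let j′ , l , _ = to (leftOf⇔ s i₀ j₀) left in
      n≮0 (subst (j′ <_) (to (dot-firstColumn n) d) l)

  complete : ConnectedBelow (firstColumn n) s → IsStaircaseCNM (toMatrix s)
  complete C = record
    { diagonal  = λ (i , j) e → from (vertex⇔cell s i j)
        (cell-diagonal s (suc-injective (trans (cong suc (sym (+-suc _ _))) e)))
    ; bounded   = λ (i , j) v → subst (_≤ suc (suc n)) (cong suc (sym (+-suc _ _)))
        (s≤s (cell-bounded s (to (vertex⇔cell s i j) v)))
    ; root      = (zero , zero) , (refl , refl) , from (vertex⇔cell s zero zero) root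
    ; connected = connected
    }
    where
    root : Cell s 0 0
    root = root-cell C n (cell-diagonal s refl)
    connected : ∀ p → Vertex (toMatrix s) p → ¬ IsRoot p →
      ExactlyOne (∃ (Above (toMatrix s) p)) (∃ (LeftOf (toMatrix s) p))
    connected (i , j) v ¬root with C _ _ (to (vertex⇔cell s i j) v)
    ... | inj₁ (inj₂ above , ¬left) = inj₁ (from (above⇔ s i j) above , ¬left ∘ to (leftOf⇔ s i j))
    ... | inj₂ (¬above , left) = inj₂ (¬above ∘ inj₂ ∘ to (above⇔ s i j) , from (leftOf⇔ s i j) left)
    -- In column 0 but not at the root, the virtual vertex above is replaced by the root itself.
    ... | inj₁ (inj₁ d , ¬left) = inj₁ (from (above⇔ s i j) (0 , n≢0⇒n>0 i≢0 , root′) , ¬left ∘ to (leftOf⇔ s i j))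
      where
      root′ : Cell s 0 (toℕ j)
      root′ = subst (Cell s 0) (sym (to (dot-firstColumn n) d)) root
      i≢0 : toℕ i ≢ 0
      i≢0 e = ¬root (cong suc e , cong suc (to (dot-firstColumn n) d))

-- The recurrences

allMatrices-complete : ∀ {n} (M : Matrix n) → M ∈ allMatrices n
allMatrices-complete = allVecs-complete allRows-complete

-- The first filtered list and the image of the second under `g` are free of duplicates and have the
-- same elements, so they are permutations of each other.
length-filter-bijection : ∀ {P : Pred A 0ℓ} {Q : Pred B 0ℓ}
  (P? : Decidable P) (Q? : Decidable Q) {xs ys} →
  Unique xs → Unique ys → (∀ x → x ∈ xs) → (∀ y → y ∈ ys) →
  (g : B → A) → (∀ {y y′} → g y ≡ g y′ → y ≡ y′) →
  (∀ x → P x → ∃ λ y → g y ≡ x) → (∀ y → P (g y) ⇔ Q y) →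
  length (filter P? xs) ≡ length (filter Q? ys)
length-filter-bijection {P = P} P? Q? {xs} {ys} xs! ys! xs-all ys-all g inj surj P⇔Q = trans
  (↭-length (∼bag⇒↭ (unique∧set⇒bag
    (Unique.filter⁺ P? xs!) (Unique.map⁺ inj (Unique.filter⁺ Q? ys!)) (mk⇔ into back))))
  (List.length-map g (filter Q? ys))
  where
  into : ∀ {x} → x ∈ filter P? xs → x ∈ map g (filter Q? ys)
  into {x} x∈ with ∈.∈-filter⁻ P? {xs = xs} x∈
  ... | _ , p with surj x p
  ...   | y , refl = ∈.∈-map⁺ g (∈.∈-filter⁺ Q? (ys-all y) (to (P⇔Q y) p))
  back : ∀ {x} → x ∈ map g (filter Q? ys) → x ∈ filter P? xs
  back x∈ with ∈.∈-map⁻ g x∈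
  ... | y , y∈ , refl with ∈.∈-filter⁻ Q? {xs = ys} y∈
  ...   | _ , q = ∈.∈-filter⁺ P? (xs-all (g y)) (from (P⇔Q y) q)

toMatrix-counted : ∀ {n} k (s : Staircase (suc n)) →
  (IsUpperDiagonalCNM (toMatrix s) × StartsAt k (toMatrix s)) ⇔
  T (startsAtᵇ k s ∧ connectedBelow (firstColumn n) s)
toMatrix-counted {n} k s = mk⇔
  (λ (ud , start) → from T-∧
    ( from (startsAtᵇ⇔ k s) (to (startsAt⇔ k s) start)
    , from (connectedBelow⇔ (firstColumn n) s)
        (to (staircaseCNM⇔ s) (upperDiagonal⇒staircase ud))))
  (λ t → let start , conn = to (T-∧ {startsAtᵇ k s}) t in
      staircase⇒upperDiagonal (from (staircaseCNM⇔ s) (to (connectedBelow⇔ (firstColumn n) s) conn))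
    , from (startsAt⇔ k s) (to (startsAtᵇ⇔ k s) start))

f≡startingAt : ∀ n k → f (suc n) (+ k) ≡ startingAt k (firstColumn n)
f≡startingAt n k = trans
  (length-filter-bijection (λ M → isUpperDiagonalCNM? M ×-dec startsAt? M k) (λ s → T? (valid s))
    (allVecs-unique (allRows-unique (suc n)) (suc n)) (allStaircases-unique (suc n))
    allMatrices-complete allStaircases-complete toMatrix toMatrix-injective
    (λ M (ud , _) → toMatrix-surjective (upperDiagonal⇒staircase ud))
    (toMatrix-counted k))
  (trans (length-filter-T valid (allStaircases (suc n))) (count-startsAt k (firstColumn n)))
  where
  valid : Staircase (suc n) → Bool
  valid s = startsAtᵇ k s ∧ connectedBelow (firstColumn n) s

-- `inject₁ i` is never the final place, so the marked column remains the leftmost one.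
firstColumn-insertAt : ∀ {n} (i : Fin (suc n)) →
  insertAt (firstColumn n) (inject₁ i) false ≡ firstColumn (suc n)
firstColumn-insertAt zero = refl
firstColumn-insertAt {suc n} (suc i) = cong (false ∷_) (firstColumn-insertAt i)

-- The first recurrence, with the sum on the right still in the form of `startingFrom`. At `k = 0`
-- the truncation in `pred` drops the index -1, whose term is 0.
startingAt-firstColumn : ∀ {n k} → k < suc n →
  startingAt k (firstColumn (suc n)) ≡ startingFrom (pred k) (firstColumn n)
startingAt-firstColumn {n} {k} k≤n = begin
  startingAt k (firstColumn (suc n))
    ≡⟨ cong₂ startingAt (sym (Fin.toℕ-fromℕ< k≤n)) (sym (firstColumn-insertAt i)) ⟩
  startingAt (toℕ i) (insertAt (firstColumn n) (inject₁ i) false)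
    ≡⟨ startingAt-insertAt (firstColumn n) i ⟩
  startingFrom (pred (toℕ i)) (firstColumn n)
    ≡⟨ cong (λ k → startingFrom (pred k) (firstColumn n)) (Fin.toℕ-fromℕ< k≤n) ⟩
  startingFrom (pred k) (firstColumn n) ∎
  where
  open ≡-Reasoning
  i = fromℕ< k≤n

-- Going from size `suc n` to `suc (suc n)` adds one unmarked column, with `suc n` columns to its
-- left. Hence the total in size `n` is `(n-1)!`.
fillings-firstColumn : ∀ n → fillings (firstColumn (suc n)) ≡ suc n ℕ.* fillings (firstColumn n)
fillings-firstColumn n = trans (fillings≡columnProduct (firstColumn (suc n)))
  (cong (suc n ℕ.*_) (sym (fillings≡columnProduct (firstColumn n))))

-- Telescoping and the last value

sumBelow weightedSumBelow : (ℕ → ℕ) → ℕ → ℕ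
sumBelow g zero    = 0
sumBelow g (suc t) = g 0 + sumBelow (g ∘ suc) t
weightedSumBelow g zero    = 0
weightedSumBelow g (suc t) = suc t ℕ.* g 0 + weightedSumBelow (g ∘ suc) t

sumBelow-cong : ∀ t {g h} → (∀ k → k < t → g k ≡ h k) → sumBelow g t ≡ sumBelow h t
sumBelow-cong zero    e = refl
sumBelow-cong (suc t) e = cong₂ _+_ (e 0 z<s) (sumBelow-cong t λ k l → e (suc k) (s<s l))

module _ where
  open ≡-Reasoning

  telescope : ∀ {c A : ℕ → ℕ} → (∀ k → A k ≡ c k + A (suc k)) → ∀ t → A 0 ≡ sumBelow c t + A t
  telescope e zero    = refl
  telescope {c} {A} e (suc t) = begin
    A 0                                     ≡⟨ e 0 ⟩
    c 0 + A 1                               ≡⟨ cong (_+_ (c 0)) (telescope (e ∘ suc) t) ⟩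
    c 0 + (sumBelow (c ∘ suc) t + A (suc t)) ≡⟨ +-assoc (c 0) _ _ ⟨
    sumBelow c (suc t) + A (suc t)          ∎

  -- Each of `A 0`, ..., `A t` falls short of `A 0` by the sum of the `c i` with smaller index. In
  -- total, `c i` is missing once for each of the `t - i` indices from `i + 1` to `t`.
  doubleTelescope : ∀ {c A : ℕ → ℕ} → (∀ k → A k ≡ c k + A (suc k)) → ∀ t →
    suc t ℕ.* A 0 ≡ sumBelow A (suc t) + weightedSumBelow c t
  doubleTelescope e zero    = sym (+-identityʳ _)
  doubleTelescope {c} {A} e (suc t) = begin
    A 0 + suc t ℕ.* A 0
      ≡⟨ cong (λ a → A 0 + suc t ℕ.* a) (e 0) ⟩
    A 0 + suc t ℕ.* (c 0 + A 1)
      ≡⟨ cong (_+_ (A 0)) (*-distribˡ-+ (suc t) (c 0) (A 1)) ⟩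
    A 0 + (suc t ℕ.* c 0 + suc t ℕ.* A 1)
      ≡⟨ cong (λ a → A 0 + (suc t ℕ.* c 0 + a)) (doubleTelescope (e ∘ suc) t) ⟩
    A 0 + (suc t ℕ.* c 0 + (sumBelow (A ∘ suc) (suc t) + weightedSumBelow (c ∘ suc) t))
      ≡⟨ solve 4 (λ a c s w → a :+ (c :+ (s :+ w)) := (a :+ s) :+ (c :+ w)) refl
           (A 0) (suc t ℕ.* c 0) (sumBelow (A ∘ suc) (suc t)) _ ⟩
    sumBelow A (suc (suc t)) + weightedSumBelow c (suc t) ∎
    where open +-*-Solver

  -- Both sides, added to the values at all smaller indices, give the same total: for the left side
  -- by telescoping, for the right side by `doubleTelescope` and the factor `2 + n` between the
  -- totals of consecutive sizes.
  startingAt-last : ∀ n →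
    startingAt (suc (suc n)) (firstColumn (suc (suc n))) ≡
    weightedSumBelow (λ k → startingAt k (firstColumn (suc n))) n
  startingAt-last n = sym (+-cancelˡ-≡ (sumBelow c′ (2 + n)) _ _ (begin
    sumBelow c′ (2 + n) + weightedSumBelow c n
      ≡⟨ cong (_+ weightedSumBelow c n)
           (sumBelow-cong (2 + n) (λ k l → startingAt-firstColumn l)) ⟩
    -- `F 0` occurs twice, since `pred` sends both 0 and 1 to 0. The second occurrence starts the
    -- sum to which `doubleTelescope` applies; the first raises the factor from `1 + n` to `2 + n`.
    (F 0 + sumBelow F (1 + n)) + weightedSumBelow c n
      ≡⟨ +-assoc (F 0) _ _ ⟩
    F 0 + (sumBelow F (1 + n) + weightedSumBelow c n)
      ≡⟨ cong (_+_ (F 0)) (doubleTelescope (λ k → startingFrom-suc k a) n) ⟨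
    suc (suc n) ℕ.* F 0
      ≡⟨ fillings-firstColumn (suc n) ⟨
    F′ 0
      ≡⟨ telescope (λ k → startingFrom-suc k a′) (2 + n) ⟩
    sumBelow c′ (2 + n) + F′ (2 + n)
      ≡⟨ cong (_+_ (sumBelow c′ (2 + n))) (trans (startingFrom-suc (2 + n) a′)
           (trans (cong (_+_ (c′ (2 + n))) (startingFrom-length a′)) (+-identityʳ _))) ⟩
    sumBelow c′ (2 + n) + c′ (2 + n) ∎))
    where
    a  = firstColumn (suc n)
    a′ = firstColumn (suc (suc n))
    c  = λ k → startingAt k a
    c′ = λ k → startingAt k a′
    F  = λ k → startingFrom k a
    F′ = λ k → startingFrom k a′

  startingFrom-sum : ∀ k {n} (a : Vec Bool (suc n)) t → k + t ≡ suc n →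
    startingFrom k a ≡ sumBelow (λ i → startingAt (k + i) a) t
  startingFrom-sum k a t k+t≡1+n = begin
    startingFrom k a
      ≡⟨ cong (λ k → startingFrom k a) (+-identityʳ k) ⟨
    startingFrom (k + 0) a
      ≡⟨ telescope {A = λ i → startingFrom (k + i) a} (λ i → trans (startingFrom-suc (k + i) a)
           (cong (λ j → startingAt (k + i) a + startingFrom j a) (sym (+-suc k i)))) t ⟩
    sumBelow (λ i → startingAt (k + i) a) t + startingFrom (k + t) a
      ≡⟨ cong (_+_ (sumBelow (λ i → startingAt (k + i) a) t)) (trans (cong (λ j → startingFrom j a) k+t≡1+n) (startingFrom-length a)) ⟩
    sumBelow (λ i → startingAt (k + i) a) t + 0
      ≡⟨ +-identityʳ _ ⟩
    sumBelow (λ i → startingAt (k + i) a) t ∎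

sumUpTo : (ℕ → ℤ) → ℕ → ℤ
sumUpTo h t = foldr ℤ._+_ (+ 0) (applyUpTo h t)

sumFromTo≡sumUpTo : ∀ a b g {t} → clip (b - a ℤ.+ + 1) ≡ t →
  sumFromTo a b g ≡ sumUpTo (λ i → g (a ℤ.+ + i)) t
sumFromTo≡sumUpTo a b g refl = cong (foldr ℤ._+_ (+ 0)) (List.map-upTo (λ i → g (a ℤ.+ + i)) (clip (b - a ℤ.+ + 1)))

sumBelow≡sumUpTo : ∀ {g : ℕ → ℕ} {h} t → (∀ i → + g i ≡ h i) → + sumBelow g t ≡ sumUpTo h t
sumBelow≡sumUpTo zero    e = refl
sumBelow≡sumUpTo {g} (suc t) e =
  trans (ℤ.pos-+ (g 0) _) (cong₂ ℤ._+_ (e 0) (sumBelow≡sumUpTo t (e ∘ suc)))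

weightedSumBelow≡sumUpTo : ∀ {g : ℕ → ℕ} {h} t → (∀ i → (+ t - + i) * + g i ≡ h i) →
  + weightedSumBelow g t ≡ sumUpTo h t
weightedSumBelow≡sumUpTo zero    e = refl
weightedSumBelow≡sumUpTo {g} {h} (suc t) e = trans (ℤ.pos-+ (suc t ℕ.* g 0) _)
  (cong₂ ℤ._+_
    (trans (ℤ.pos-* (suc t) (g 0)) (trans (cong (λ z → + z * + g 0) (sym (+-identityʳ (suc t)))) (e 0)))
    (weightedSumBelow≡sumUpTo t λ i → trans (cong (_* + g (suc i)) (shift i)) (e (suc i))))
  where
  shift : ∀ i → + t - + i ≡ + suc t - + suc i
  shift i = trans (ℤ.m-n≡m⊖n t i) (trans (sym (ℤ.[1+m]⊖[1+n]≡m⊖n t i)) (sym (ℤ.m-n≡m⊖n (suc t) (suc i))))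

theorem4p6 : ∀ (n : ℕ) → 3 ≤ n →
    (∀ (k : ℕ) → k < n ∸ 1 →
    + f n (+ k) ≡ (Σ[ j from (+ k - + 1) to (+ n - + 2) ] (+ f (n ∸ 1) j)))
    ×
    (+ f n (+ n - + 1) ≡
    (Σ[ j from (+ 0) to (+ n - + 4) ] ((+ n - + 3 - j) * (+ f (n ∸ 1) j))))
theorem4p6 (suc (suc (suc n))) (s≤s (s≤s (s≤s z≤n))) = first , second
  where
  open ≡-Reasoning
  a = firstColumn (suc n)

  tailSum : ∀ k t → k + t ≡ suc (suc n) →
    + startingFrom k a ≡ sumUpTo (λ i → + f (suc (suc n)) (+ (k + i))) t
  tailSum k t e = trans (cong +_ (startingFrom-sum k a t e))
    (sumBelow≡sumUpTo t λ i → cong +_ (sym (f≡startingAt (suc n) (k + i))))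

  first : ∀ k → k < suc (suc n) → + f (3 + n) (+ k) ≡
    (Σ[ j from (+ k - + 1) to (+ (3 + n) - + 2) ] (+ f (2 + n) j))
  first zero l = begin
    + f (3 + n) (+ 0)
      ≡⟨ cong +_ (trans (f≡startingAt (2 + n) 0) (startingAt-firstColumn l)) ⟩
    + startingFrom 0 a
      ≡⟨ tailSum 0 (2 + n) refl ⟩
    sumUpTo (λ i → + f (2 + n) (+ i)) (2 + n)
      -- The added term has index -1, where `f` is 0 by convention.
      ≡⟨ ℤ.+-identityˡ _ ⟨
    sumUpTo (λ i → + f (2 + n) (ℤ.-1ℤ ℤ.+ + i)) (3 + n)
      ≡⟨ sumFromTo≡sumUpTo ℤ.-1ℤ (+ suc n) (λ j → + f (2 + n) j) terms ⟨
    sumFromTo (ℤ.-1ℤ) (+ suc n) (λ j → + f (2 + n) j) ∎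
    where
    terms : suc n + 1 + 1 ≡ 3 + n
    terms = trans (cong (_+ 1) (+-comm (suc n) 1)) (+-comm (2 + n) 1)
  first (suc k) l = begin
    + f (3 + n) (+ suc k)
      ≡⟨ cong +_ (trans (f≡startingAt (2 + n) (suc k)) (startingAt-firstColumn l)) ⟩
    + startingFrom k a
      ≡⟨ tailSum k (suc (suc n ∸ k)) (trans (+-suc k _) (cong suc (m+[n∸m]≡n k≤n))) ⟩
    sumUpTo (λ i → + f (2 + n) (+ (k + i))) (suc (suc n ∸ k))
      ≡⟨ sumFromTo≡sumUpTo (+ k) (+ suc n) (λ j → + f (2 + n) j) terms ⟨
    sumFromTo (+ k) (+ suc n) (λ j → + f (2 + n) j) ∎
    where
    k≤n : k ≤ suc n
    k≤n = <⇒≤ (s≤s⁻¹ l)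
    terms : clip (+ suc n - + k ℤ.+ + 1) ≡ suc (suc n ∸ k)
    terms = trans (cong (λ z → clip (z ℤ.+ + 1)) (trans (ℤ.m-n≡m⊖n (suc n) k) (ℤ.⊖-≥ k≤n)))
                  (+-comm (suc n ∸ k) 1)

  second : + f (3 + n) (+ (2 + n)) ≡
    (Σ[ j from (+ 0) to (+ (3 + n) - + 4) ] ((+ n - j) * (+ f (2 + n) j)))
  second = begin
    + f (3 + n) (+ (2 + n))
      ≡⟨ cong +_ (trans (f≡startingAt (2 + n) (2 + n)) (startingAt-last n)) ⟩
    + weightedSumBelow (λ k → startingAt k a) n
      ≡⟨ weightedSumBelow≡sumUpTo n
           (λ i → cong (λ c → (+ n - + i) * + c) (sym (f≡startingAt (suc n) i))) ⟩
    sumUpTo (λ i → (+ n - + i) * + f (2 + n) (+ i)) n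
      ≡⟨ sumFromTo≡sumUpTo (+ 0) (+ (3 + n) - + 4) (λ j → (+ n - j) * + f (2 + n) j) (terms n) ⟨
    sumFromTo (+ 0) (+ (3 + n) - + 4) (λ j → (+ n - j) * (+ f (2 + n) j)) ∎
    where
    terms : ∀ n → clip (+ (3 + n) - + 4 - + 0 ℤ.+ + 1) ≡ n
    -- In size 3 the upper bound is -1 and the sum is empty.
    terms zero    = refl
    terms (suc n) = trans (+-comm (n + 0) 1) (cong suc (+-identityʳ n))
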